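{- (i) Let $S\equiv\pm\{1, 3, 4, 5, 6, 7, 13, 15, 16, 17, 18, 19\}\pmod{40}$ and $T\equiv\pm\{1, 2, 3, 5, 9, 11, 12, 15, 16, 17, 18, 19\}\pmod{40}$. Then $p(S,n)=p(T,n-1)$ for all $n\geq 1$. (ii) Let $S\equiv\pm\{3, 4, 5, 6, 7, 8, 9, 11, 13, 14, 15, 17\}\pmod{40}$ and $T\equiv\pm\{1, 3, 5, 8, 9, 11, 12, 14, 15, 17, 18, 19\}\pmod{40}$. Then $p(S,n)=p(T,n-3)$ for all $n\geq 3$. (iii) Let $S\equiv\pm\{1, 3, 4, 5, 6, 7, 8, 13, 14, 15, 17, 19\}\pmod{40}$ and $T\equiv\pm\{1, 2, 5, 6, 7, 8, 9, 11, 12, 13, 15, 19\}\pmod{40}$. Then $p(S,n)=p(T,n)$ for all integers $n\ge 0$ with $n\neq 2$. (iv) Let $S\equiv\pm\{2, 3, 4, 5, 7, 9, 11, 13, 14, 15, 16, 17\}\pmod{40}$ and $T\equiv\pm\{1, 2, 5, 7, 9, 11, 12, 13, 15, 16, 18, 19\}\pmod{40}$. Then $p(S,n)=p(T,n-2)$ for all $n\geq 2$.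
   Context: For a set $S$ of positive integers and an integer $n\ge 0$, $p(S,n)$ denotes the number of partitions of $n$ into parts belonging to $S$ (so $p(S,0)=1$). The notation $S\equiv\pm\{r_1,\dots,r_k\}\pmod M$ means that $S$ is the set of all positive integers $n$ such that $n\equiv r_i$ or $n\equiv -r_i\pmod M$ for some $i$. -}

module Defs where

open import Data.Nat using (ℕ; zero; suc; _+_; _*_; _∸_; _≤ᵇ_; _≡ᵇ_)
open import Data.Nat.DivMod using (_%_)
open import Data.Bool using (Bool; true; false; if_then_else_; _∨_)
open import Data.List using (List; []; _∷_)
open import Data.Bool.ListAction using (any)

PosSet : Set
PosSet = ℕ → Bool

-- S ≡ ±{r₁,…,r_k} (mod M), for M = 40: all positive n with n ≡ ±rᵢ (mod 40).
-- n ≡ -r (mod 40)  iff  n % 40 ≡ (40 - r % 40) % 40.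
pm40 : List ℕ → PosSet
pm40 rs zero = false
pm40 rs (suc m) =
  any (λ r → ((suc m % 40) ≡ᵇ (r % 40)) ∨ ((suc m % 40) ≡ᵇ ((40 ∸ (r % 40)) % 40))) rs

sumMult : (k : ℕ) → (ℕ → ℕ) → ℕ → ℕ → ℕ
sumMult k f n zero = f n
sumMult k f n (suc t) = f n + (if suc k ≤ᵇ n then sumMult k f (n ∸ suc k) t else 0)

pBounded : PosSet → ℕ → ℕ → ℕ
pBounded S zero n = if n ≡ᵇ 0 then 1 else 0
pBounded S (suc k) n =
  if S (suc k)
    then sumMult k (pBounded S k) n n
    else pBounded S k n

p : PosSet → ℕ → ℕ
p S n = pBounded S n n

{-# OPTIONS --safe #-}
-- Let [±c] be the theta product over k ≥ 0 of (1 ∓ q^(20k+c)) (1 ∓ q^(20k+20-c)).  Each of the four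
-- identities is an instance of Weierstrass' three-term relation
--   T₁₂ T₃₄ - T₁₃ T₂₄ + T₁₄ T₂₃ = 0   (up to signs and powers of q),   Tᵢⱼ = [xᵢxⱼ] [xᵢ/xⱼ],
-- for points xᵢ = ± q^aᵢ to the base q²⁰.  Since [-c] [c] is a product of factors 1 - q^n over residues
-- modulo 40, dividing the relation by one of its terms leaves 1 and the generating functions of
-- p(S, n) and p(T, n), one of them or the 1 multiplied by a power of q.
--
-- The relation is Plücker's identity for 2 × 2 minors.  By the Jacobi triple product both factors of
-- Tᵢⱼ are bilateral sums; splitting the double sum over (m, n) by the parity of m + n gives
-- Tᵢⱼ = ξᵢ ηⱼ - ηᵢ ξⱼ up to a monomial.
--
-- Only finitely many coefficients matter at a time, so q may be taken nilpotent (ℤ[[q]] modulo q^N),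
-- which makes every product and every sum finite.
module Submission where

open import Defs
open import Algebra.Bundles using (CommutativeRing)
import Algebra.Properties.CommutativeSemigroup
import Algebra.Properties.Ring
import Algebra.Properties.Semiring.Exp
import Algebra.Solver.Ring
open import Algebra.Solver.Ring.AlmostCommutativeRing using (_-Raw-AlmostCommutative⟶_; fromCommutativeRing)
open import Algebra.Structures using (IsCommutativeRing)
open import Data.Bool.Base using (Bool; true; false; if_then_else_; T; _∨_)
open import Data.Bool.ListAction using (any)
open import Data.Integer.Base as Int using (ℤ; +_; -[1+_]; ∣_∣; +≤+)
import Data.Integer.Properties as ℤₚ
import Data.Integer.Solver
open import Data.List.Base using (List; []; _∷_; _++_)
open import Data.List.Relation.Binary.Permutation.Propositional as Perm using (_↭_)
open import Data.Maybe.Base as Maybe using (Maybe)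
open import Data.Nat as ℕ using (ℕ; zero; suc; _∸_; _≤_; _<_; z≤n; s≤s)
open import Data.Nat.DivMod using (_%_; [m+kn]%n≡m%n)
import Data.Nat.Properties as ℕₚ
import Data.Nat.Solver
open import Data.List.Sort.InsertionSort ℕₚ.≤-decTotalOrder using (sort)
open import Data.List.Sort.InsertionSort.Properties ℕₚ.≤-decTotalOrder using (sort-↭)
open import Data.Product as Product using (∃; _×_; _,_; proj₁; proj₂; swap)
open import Data.Sign.Base as Sgn using (Sign)
open import Data.Sum using (inj₁; inj₂)
open import Function using (flip)
open import Level using (0ℓ)
open import Relation.Binary.PropositionalEquality as ≡ using (_≡_; _≢_)
import Relation.Binary.Reasoning.Setoid
open import Relation.Nullary using (yes; no; contradiction)
open import Relation.Nullary.Decidable using (dec⇒maybe)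

-- A nilpotent `q` has no inverse, and this shapes the whole argument. Exponents have to stay
-- natural numbers: the points are ordered by decreasing exponent, and every theta argument has an
-- exponent strictly between 0 and 20, where the exponent of the j-th term of the bilateral sum is
-- at least |j|. Signs are kept as elements of square 1, so that their negative powers need no
-- inverse either. Nor can powers of `q` be cancelled. Plücker's identity yields the relation
-- multiplied by x₃x₄; this power of `q` survives to the end and costs that many top coefficients,
-- so `N` exceeds the degree of interest accordingly. The shifts in the four identities are the
-- exponents of x₂/x₃, the surplus of T₁₂T₃₄ over the other two products. In (iii) the relation is
-- divided by T₁₂T₃₄ itself, so the shift falls on the 1 and produces the exceptional n = 2. The
-- factors 1 + x become (1 - x²)/(1 - x), so each theta product is a fraction in the factors 1 - q^n
-- sorted by n modulo 40. That a term of the relation is the generating function of `S` or `T` is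
-- then a cancellation between lists of residues, decided by computation.

module PowerSeries where
  open ≡
  open Int using (_+_; _*_; -_; 0ℤ; 1ℤ)

  -- Integer power series under convolution

  Series : Set
  Series = ℕ → ℤ

  tail : Series → Series
  tail f n = f (suc n)

  conv : Series → Series → Series
  conv f g zero = f 0 * g 0
  conv f g (suc n) = f 0 * g (suc n) + conv (tail f) g n

  const : ℤ → Series
  const c zero = c
  const c (suc n) = 0ℤ

  X : Series
  X zero = 0ℤ
  X (suc n) = const 1ℤ n

  conv-cong : ∀ {f f′ g g′} n → (∀ i → i ≤ n → f i ≡ f′ i) → (∀ i → i ≤ n → g i ≡ g′ i) →
    conv f g n ≡ conv f′ g′ n
  conv-cong zero p r = cong₂ _*_ (p 0 z≤n) (r 0 z≤n)
  conv-cong (suc n) p r = cong₂ _+_ (cong₂ _*_ (p 0 z≤n) (r (suc n) ℕₚ.≤-refl))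
    (conv-cong n (λ i i≤n → p (suc i) (s≤s i≤n)) (λ i i≤n → r i (ℕₚ.m≤n⇒m≤1+n i≤n)))

  conv-zeroˡ : ∀ g n → conv (λ _ → 0ℤ) g n ≡ 0ℤ
  conv-zeroˡ g zero = refl
  conv-zeroˡ g (suc n) = trans (ℤₚ.+-identityˡ _) (conv-zeroˡ g n)

  conv-constˡ : ∀ c g n → conv (const c) g n ≡ c * g n
  conv-constˡ c g zero = refl
  conv-constˡ c g (suc n) = trans (cong (λ x → c * g (suc n) + x) (conv-zeroˡ g n)) (ℤₚ.+-identityʳ _)

  conv-distribʳ : ∀ h f g n → conv (λ i → f i + g i) h n ≡ conv f h n + conv g h n
  conv-distribʳ h f g zero = ℤₚ.*-distribʳ-+ (h 0) (f 0) (g 0)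
  conv-distribʳ h f g (suc n) = trans
    (cong (λ x → (f 0 + g 0) * h (suc n) + x) (conv-distribʳ h (tail f) (tail g) n))
    (solve 5 (λ a b c d e → (a :+ b) :* c :+ (d :+ e) := (a :* c :+ d) :+ (b :* c :+ e)) refl
      (f 0) (g 0) (h (suc n)) (conv (tail f) h n) (conv (tail g) h n))
    where open Data.Integer.Solver.+-*-Solver

  conv-scaleˡ : ∀ c f h n → conv (λ i → c * f i) h n ≡ c * conv f h n
  conv-scaleˡ c f h zero = ℤₚ.*-assoc c (f 0) (h 0)
  conv-scaleˡ c f h (suc n) = trans
    (cong₂ _+_ (ℤₚ.*-assoc c (f 0) (h (suc n))) (conv-scaleˡ c (tail f) h n))
    (sym (ℤₚ.*-distribˡ-+ c _ _))

  -- `conv` peels coefficients off its first argument. Peeling them off the second is the mirrored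
  -- recursion, which makes commutativity an induction.
  conv-snoc : ∀ f g n → conv f g (suc n) ≡ f (suc n) * g 0 + conv f (tail g) n
  conv-snoc f g zero = ℤₚ.+-comm (f 0 * g 1) (f 1 * g 0)
  conv-snoc f g (suc n) = trans
    (cong (λ x → f 0 * g (suc (suc n)) + x) (conv-snoc (tail f) g n))
    (solve 3 (λ a b c → a :+ (b :+ c) := b :+ (a :+ c)) refl
      (f 0 * g (suc (suc n))) (f (suc (suc n)) * g 0) (conv (tail f) (tail g) n))
    where open Data.Integer.Solver.+-*-Solver

  conv-comm : ∀ f g n → conv f g n ≡ conv g f n
  conv-comm f g zero = ℤₚ.*-comm (f 0) (g 0)
  conv-comm f g (suc n) = trans
    (cong₂ _+_ (ℤₚ.*-comm (f 0) (g (suc n))) (conv-comm (tail f) g n))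
    (sym (conv-snoc g f n))

  conv-assoc : ∀ f g h n → conv (conv f g) h n ≡ conv f (conv g h) n
  conv-assoc f g h zero = ℤₚ.*-assoc (f 0) (g 0) (h 0)
  conv-assoc f g h (suc n) = begin
    f 0 * g 0 * h (suc n) + conv (λ i → f 0 * tail g i + conv (tail f) g i) h n
      ≡⟨ cong (λ x → f 0 * g 0 * h (suc n) + x) (conv-distribʳ h (λ i → f 0 * tail g i) (conv (tail f) g) n) ⟩
    f 0 * g 0 * h (suc n) + (conv (λ i → f 0 * tail g i) h n + conv (conv (tail f) g) h n)
      ≡⟨ cong (λ x → f 0 * g 0 * h (suc n) + x) (cong₂ _+_ (conv-scaleˡ (f 0) (tail g) h n) (conv-assoc (tail f) g h n)) ⟩
    f 0 * g 0 * h (suc n) + (f 0 * conv (tail g) h n + conv (tail f) (conv g h) n)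
      ≡⟨ solve 5 (λ a b c d e → a :* b :* c :+ (a :* d :+ e) := a :* (b :* c :+ d) :+ e) refl
           (f 0) (g 0) (h (suc n)) (conv (tail g) h n) (conv (tail f) (conv g h) n) ⟩
    f 0 * (g 0 * h (suc n) + conv (tail g) h n) + conv (tail f) (conv g h) n ∎
    where
    open Data.Integer.Solver.+-*-Solver
    open ≡-Reasoning

  conv-Xˡ-suc : ∀ g n → conv X g (suc n) ≡ g n
  conv-Xˡ-suc g n = trans (ℤₚ.+-identityˡ _) (trans (conv-constˡ 1ℤ g n) (ℤₚ.*-identityˡ (g n)))

-- The ring of power series modulo X^N

module Truncated (N : ℕ) where
  open ≡
  open PowerSeries
  open Int using (_+_; _*_; -_; 0ℤ; 1ℤ)

  infix 4 _≈_
  -- Congruence modulo X^N, wrapped in a record so that unification can recover `f` and `g` from the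
  -- type of an equation.
  record _≈_ (f g : Series) : Set where
    constructor mk≈
    field coeff : ∀ n → n < N → f n ≡ g n
  open _≈_ public

  pointwise : ∀ {f g} → (∀ n → f n ≡ g n) → f ≈ g
  pointwise p = mk≈ (λ n _ → p n)

  conv-resp : ∀ {f f′ g g′} → f ≈ f′ → g ≈ g′ → conv f g ≈ conv f′ g′
  conv-resp p r = mk≈ λ n n<N → conv-cong n
    (λ i i≤n → coeff p i (ℕₚ.≤-<-trans i≤n n<N)) (λ i i≤n → coeff r i (ℕₚ.≤-<-trans i≤n n<N))

  isCommutativeRing : IsCommutativeRing _≈_ (λ f g n → f n + g n) conv (λ f n → - f n) (λ _ → 0ℤ) (const 1ℤ)
  isCommutativeRing = record
    { isRing = record
      { +-isAbelianGroup = record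
        { isGroup = record
          { isMonoid = record
            { isSemigroup = record
              { isMagma = record
                { isEquivalence = record
                  { refl = pointwise (λ _ → refl)
                  ; sym = λ p → mk≈ λ n l → sym (coeff p n l)
                  ; trans = λ p r → mk≈ λ n l → trans (coeff p n l) (coeff r n l) }
                ; ∙-cong = λ p r → mk≈ λ n l → cong₂ _+_ (coeff p n l) (coeff r n l) }
              ; assoc = λ f g h → pointwise λ n → ℤₚ.+-assoc (f n) (g n) (h n) }
            ; identity = (λ f → pointwise λ n → ℤₚ.+-identityˡ (f n)) , (λ f → pointwise λ n → ℤₚ.+-identityʳ (f n)) }
          ; inverse = (λ f → pointwise λ n → ℤₚ.+-inverseˡ (f n)) , (λ f → pointwise λ n → ℤₚ.+-inverseʳ (f n))
          ; ⁻¹-cong = λ p → mk≈ λ n l → cong -_ (coeff p n l) }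
        ; comm = λ f g → pointwise λ n → ℤₚ.+-comm (f n) (g n) }
      ; *-cong = conv-resp
      ; *-assoc = λ f g h → pointwise (conv-assoc f g h)
      ; *-identity = (λ f → pointwise (one-left f))
                   , (λ f → pointwise λ n → trans (conv-comm f _ n) (one-left f n))
      ; distrib = (λ h f g → pointwise λ n → trans (conv-comm h _ n)
                      (trans (conv-distribʳ h f g n) (cong₂ _+_ (conv-comm f h n) (conv-comm g h n))))
                , (λ h f g → pointwise (conv-distribʳ h f g)) }
    ; *-comm = λ f g → pointwise (conv-comm f g) }
    where
    one-left : ∀ f n → conv (const 1ℤ) f n ≡ f n
    one-left f n = trans (conv-constˡ 1ℤ f n) (ℤₚ.*-identityˡ (f n))

  commutativeRing : CommutativeRing 0ℓ 0ℓ
  commutativeRing = record { isCommutativeRing = isCommutativeRing }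

  constants : Int.+-*-rawRing -Raw-AlmostCommutative⟶ fromCommutativeRing commutativeRing
  constants = record
    { ⟦_⟧ = const
    ; +-homo = λ a b → pointwise λ { zero → refl ; (suc n) → refl }
    ; *-homo = λ a b → pointwise λ { zero → refl ; (suc n) → sym (trans (conv-constˡ a (const b) (suc n)) (ℤₚ.*-zeroʳ a)) }
    ; -‿homo = λ a → pointwise λ { zero → refl ; (suc n) → refl }
    ; 0-homo = pointwise λ { zero → refl ; (suc n) → refl }
    ; 1-homo = pointwise λ _ → refl }

  open CommutativeRing commutativeRing using (semiring)
  open import Algebra.Properties.Semiring.Exp semiring using (_^_)

  X^-coeff : ∀ k g n → conv (X ^ k) g (k ℕ.+ n) ≡ g n
  X^-coeff zero g n = trans (conv-constˡ 1ℤ g n) (ℤₚ.*-identityˡ (g n))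
  X^-coeff (suc k) g n = trans (conv-assoc X (X ^ k) g (suc (k ℕ.+ n)))
    (trans (conv-Xˡ-suc (conv (X ^ k) g) (k ℕ.+ n)) (X^-coeff k g n))

  X^-coeff-< : ∀ k g n → n < k → conv (X ^ k) g n ≡ 0ℤ
  X^-coeff-< (suc k) g zero _ = trans (conv-assoc X (X ^ k) g 0) refl
  X^-coeff-< (suc k) g (suc n) (s≤s n<k) = trans (conv-assoc X (X ^ k) g (suc n))
    (trans (conv-Xˡ-suc (conv (X ^ k) g) n) (X^-coeff-< k g n n<k))

  X^N≈0 : X ^ N ≈ (λ _ → 0ℤ)
  X^N≈0 = mk≈ λ n n<N → trans (sym (trans (conv-comm (X ^ N) (const 1ℤ) n) (trans (conv-constˡ 1ℤ _ n) (ℤₚ.*-identityˡ _))))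
    (X^-coeff-< N (const 1ℤ) n n<N)

-- Exponents of the theta sums: bounds and identities

module Integers where
  open Int using (_+_; _-_; _*_; -_; _⊖_; 0ℤ; 1ℤ)
  open Data.Integer.Solver.+-*-Solver using (solve; _:=_; _:+_; _:-_; _:*_; :-_; con)

  suc-sub-suc : ∀ a L → + suc a - + suc L ≡ + a - + L
  suc-sub-suc a L = ≡.trans (ℤₚ.[1+m]⊖[1+n]≡m⊖n a L) (≡.sym (ℤₚ.m-n≡m⊖n a L))

  last-index : ∀ L → + suc (suc (L ℕ.+ L ℕ.+ 0)) - + suc L ≡ + suc L
  last-index L = solve 1 (λ l → (con (+ 2) :+ (l :+ l :+ con (+ 0))) :- (con (+ 1) :+ l) := con (+ 1) :+ l) ≡.refl (+ L)

  suc-neg : ∀ L → Int.suc -[1+ L ] ≡ - (+ L)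
  suc-neg zero = ≡.refl
  suc-neg (suc L) = ≡.refl

  +-sub-cancel : ∀ j s → j + s - s ≡ j
  +-sub-cancel = solve 2 (λ j s → j :+ s :- s := j) ≡.refl

  suc-+ : ∀ j s → Int.suc j + + s ≡ j + + suc s
  suc-+ j s = solve 2 (λ j s → con 1ℤ :+ j :+ s := j :+ (con 1ℤ :+ s)) ≡.refl j (+ s)

  even-reindex : ∀ s t → s + s - (t + s) ≡ s - t
  even-reindex = solve 2 (λ s t → s :+ s :- (t :+ s) := s :- t) ≡.refl

  odd-reindex : ∀ s t → Int.suc (s + s) - (t + Int.suc s) ≡ s - t
  odd-reindex = solve 2 (λ s t → con 1ℤ :+ (s :+ s) :- (t :+ (con 1ℤ :+ s)) := s :- t) ≡.refl

  suc-right : ∀ s t → t + Int.suc s ≡ Int.suc (t + s)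
  suc-right = solve 2 (λ s t → t :+ (con 1ℤ :+ s) := con 1ℤ :+ (t :+ s)) ≡.refl

  ∣i∣≤∣i+j∣+∣j∣ : ∀ i j → ∣ i ∣ ≤ ∣ i + j ∣ ℕ.+ ∣ j ∣
  ∣i∣≤∣i+j∣+∣j∣ i j = ≡.subst (λ k → ∣ k ∣ ≤ ∣ i + j ∣ ℕ.+ ∣ j ∣) (+-sub-cancel i j) (ℤₚ.∣i-j∣≤∣i∣+∣j∣ (i + j) j)

  ∣i+i∣ : ∀ i → ∣ i + i ∣ ≡ ∣ i ∣ ℕ.+ ∣ i ∣
  ∣i+i∣ (+ n) = ≡.refl
  ∣i+i∣ -[1+ n ] = ≡.cong suc (≡.sym (ℕₚ.+-suc n n))

  far-summand : ∀ {K} i j → K ℕ.+ K ≤ ∣ i ∣ → ∣ j ∣ < K → K ≤ ∣ i - j ∣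
  far-summand {K} i j 2K≤i j<K = ℕₚ.+-cancelʳ-≤ K K _ (begin
    K ℕ.+ K              ≤⟨ 2K≤i ⟩
    ∣ i ∣                ≤⟨ ∣i∣≤∣i+j∣+∣j∣ i (- j) ⟩
    ∣ i - j ∣ ℕ.+ ∣ - j ∣ ≡⟨ ≡.cong (∣ i - j ∣ ℕ.+_) (ℤₚ.∣-i∣≡∣i∣ j) ⟩
    ∣ i - j ∣ ℕ.+ ∣ j ∣   ≤⟨ ℕₚ.+-monoʳ-≤ ∣ i - j ∣ (ℕₚ.<⇒≤ j<K) ⟩
    ∣ i - j ∣ ℕ.+ K ∎)
    where open ℕₚ.≤-Reasoning

  far-even : ∀ {K} s → K ≤ ∣ s ∣ → K ℕ.+ K ≤ ∣ s + s ∣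
  far-even s K≤s = ≡.subst (_ ≤_) (≡.sym (∣i+i∣ s)) (ℕₚ.+-mono-≤ K≤s K≤s)

  far-odd : ∀ {K} s → K < ∣ Int.suc s ∣ → K ℕ.+ K ≤ ∣ Int.suc (s + s) ∣
  far-odd {K} s K<s = ℕₚ.≤-trans (ℕₚ.n≤1+n _) (ℕₚ.+-cancelʳ-≤ 1 _ _ (begin
    suc (K ℕ.+ K) ℕ.+ 1                 ≡⟨ ≡.trans (ℕₚ.+-comm (suc (K ℕ.+ K)) 1) (≡.cong suc (≡.sym (ℕₚ.+-suc K K))) ⟩
    suc K ℕ.+ suc K                     ≤⟨ far-even (Int.suc s) K<s ⟩
    ∣ Int.suc s + Int.suc s ∣           ≡⟨ ≡.cong ∣_∣ (solve 1 (λ s → con 1ℤ :+ s :+ (con 1ℤ :+ s) := con 1ℤ :+ (s :+ s) :+ con 1ℤ) ≡.refl s) ⟩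
    ∣ Int.suc (s + s) + 1ℤ ∣            ≤⟨ ℤₚ.∣i+j∣≤∣i∣+∣j∣ (Int.suc (s + s)) 1ℤ ⟩
    ∣ Int.suc (s + s) ∣ ℕ.+ 1 ∎))
    where open ℕₚ.≤-Reasoning

  -- The exponent of the j-th term of the theta sum to the base q²⁰, where `c` is the exponent of
  -- the argument.
  quad : ℤ → ℤ → ℤ
  quad c j = + 10 * (j * (j - 1ℤ)) + c * j

  quad-zero : ∀ c → quad c 0ℤ ≡ 0ℤ
  quad-zero c = ≡.trans (ℤₚ.+-identityˡ (c * 0ℤ)) (ℤₚ.*-zeroʳ c)

  quad-suc : ∀ c j → quad c (Int.suc j) ≡ quad c j + (+ 20 * j + c)
  quad-suc = solve 2 (λ c j → con (+ 10) :* ((con 1ℤ :+ j) :* (con 1ℤ :+ j :- con 1ℤ)) :+ c :* (con 1ℤ :+ j)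
    := con (+ 10) :* (j :* (j :- con 1ℤ)) :+ c :* j :+ (con (+ 20) :* j :+ c)) ≡.refl

  ≤-from-sum : ∀ {i} n k → i ≡ + n + + k → + n Int.≤ i
  ≤-from-sum n k ≡.refl = +≤+ (ℕₚ.m≤m+n n k)

  pos-linear : ∀ a x b y → + (a ℕ.* x ℕ.+ b ℕ.* y) ≡ + a * + x + + b * + y
  pos-linear a x b y = ≡.cong₂ _+_ (ℤₚ.pos-* a x) (ℤₚ.pos-* b y)

  -- Here c = `suc d` lies strictly between 0 and 20, and 20 - c = `suc d′`. At j = m + 1 the value
  -- is (m + 1)(10m + c), at j = -(m + 1) it is (m + 1)(10m + 20 - c): reflection exchanges c and 20
  -- - c. It follows that terms with |j| ≥ N vanish.
  quad-bound : ∀ d d′ → d ℕ.+ d′ ≡ 18 → ∀ j → + ∣ j ∣ Int.≤ quad (+ suc d) j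
  quad-bound d d′ eq (+ zero) = ≤-from-sum 0 0 (quad-zero (+ suc d))
  quad-bound d d′ eq (+ suc m) = ≤-from-sum (suc m) (10 ℕ.* (suc m ℕ.* m) ℕ.+ d ℕ.* suc m) (begin
    quad (+ suc d) (+ suc m)
      ≡⟨ solve 2 (λ d m → con (+ 10) :* ((con 1ℤ :+ m) :* (con 1ℤ :+ m :- con 1ℤ)) :+ (con 1ℤ :+ d) :* (con 1ℤ :+ m)
           := con 1ℤ :+ m :+ (con (+ 10) :* ((con 1ℤ :+ m) :* m) :+ d :* (con 1ℤ :+ m))) ≡.refl (+ d) (+ m) ⟩
    + suc m + (+ 10 * (+ suc m * + m) + + d * + suc m)
      ≡⟨ ≡.cong (λ x → + suc m + (+ 10 * x + + d * + suc m)) (ℤₚ.pos-* (suc m) m) ⟨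
    + suc m + (+ 10 * + (suc m ℕ.* m) + + d * + suc m)
      ≡⟨ ≡.cong (λ x → + suc m + x) (pos-linear 10 (suc m ℕ.* m) d (suc m)) ⟨
    + suc m + + (10 ℕ.* (suc m ℕ.* m) ℕ.+ d ℕ.* suc m) ∎)
    where open ≡.≡-Reasoning
  quad-bound d d′ eq -[1+ m ] = ≤-from-sum (suc m) (10 ℕ.* (suc m ℕ.* m) ℕ.+ d′ ℕ.* suc m) (begin
    quad (+ suc d) -[1+ m ]
      ≡⟨ solve 3 (λ d d′ m → con (+ 10) :* (:- (con 1ℤ :+ m) :* (:- (con 1ℤ :+ m) :- con 1ℤ)) :+ (con 1ℤ :+ d) :* (:- (con 1ℤ :+ m))
           := con 1ℤ :+ m :+ (con (+ 10) :* ((con 1ℤ :+ m) :* m) :+ d′ :* (con 1ℤ :+ m)) :+ (con (+ 18) :- (d :+ d′)) :* (con 1ℤ :+ m)) ≡.refl (+ d) (+ d′) (+ m) ⟩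
    + suc m + (+ 10 * (+ suc m * + m) + + d′ * + suc m) + (+ 18 - + (d ℕ.+ d′)) * + suc m
      ≡⟨ ≡.cong (λ x → + suc m + (+ 10 * (+ suc m * + m) + + d′ * + suc m) + (+ 18 - + x) * + suc m) eq ⟩
    + suc m + (+ 10 * (+ suc m * + m) + + d′ * + suc m) + 0ℤ
      ≡⟨ ℤₚ.+-identityʳ _ ⟩
    + suc m + (+ 10 * (+ suc m * + m) + + d′ * + suc m)
      ≡⟨ ≡.cong (λ x → + suc m + (+ 10 * x + + d′ * + suc m)) (ℤₚ.pos-* (suc m) m) ⟨
    + suc m + (+ 10 * + (suc m ℕ.* m) + + d′ * + suc m)
      ≡⟨ ≡.cong (λ x → + suc m + x) (pos-linear 10 (suc m ℕ.* m) d′ (suc m)) ⟨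
    + suc m + + (10 ℕ.* (suc m ℕ.* m) ℕ.+ d′ ℕ.* suc m) ∎)
    where open ≡.≡-Reasoning

  quad-nonneg : ∀ d d′ → d ℕ.+ d′ ≡ 18 → ∀ j → 0ℤ Int.≤ quad (+ suc d) j
  quad-nonneg d d′ eq j = ℤₚ.≤-trans (+≤+ z≤n) (quad-bound d d′ eq j)

  quad-far : ∀ d d′ → d ℕ.+ d′ ≡ 18 → ∀ j → ∣ j ∣ ≤ ∣ quad (+ suc d) j ∣
  quad-far d d′ eq j = ℤₚ.drop‿+≤+ (≡.subst (+ ∣ j ∣ Int.≤_) (≡.sym (ℤₚ.0≤i⇒+∣i∣≡i (quad-nonneg d d′ eq j))) (quad-bound d d′ eq j))

  -- Together with `down-exponent` this supplies the exponents in the hypothesis of `binomial-step`.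
  -- By `quad-suc` the increment of `quad` at j = a - M is 20j + c, and a + b = M + k turns 20j into
  -- 20(k - b).
  up-exponent : ∀ d M k a b → a ℕ.+ b ≡ M ℕ.+ k →
    + (suc d ℕ.+ k ℕ.* 20) + quad (+ suc d) (+ a - + M) ≡ + (20 ℕ.* b) + quad (+ suc d) (Int.suc (+ a - + M))
  up-exponent d M k a b eq = begin
    + suc d + + (k ℕ.* 20) + quad (+ suc d) j
      ≡⟨ ≡.cong (λ x → + suc d + x + quad (+ suc d) j) (ℤₚ.pos-* k 20) ⟩
    + suc d + + k * + 20 + quad (+ suc d) j
      ≡⟨ solve 6 (λ c e k a b M → c :+ k :* con (+ 20) :+ e
           := con (+ 20) :* b :+ (e :+ (con (+ 20) :* (a :- M) :+ c)) :+ con (+ 20) :* (M :+ k :- (a :+ b))) ≡.refl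
           (+ suc d) (quad (+ suc d) j) (+ k) (+ a) (+ b) (+ M) ⟩
    + 20 * + b + (quad (+ suc d) j + (+ 20 * j + + suc d)) + + 20 * (+ (M ℕ.+ k) - + (a ℕ.+ b))
      ≡⟨ ≡.cong₂ (λ x y → + 20 * + b + x + + 20 * (+ (M ℕ.+ k) - + y)) (≡.sym (quad-suc (+ suc d) j)) eq ⟩
    + 20 * + b + quad (+ suc d) (Int.suc j) + + 20 * (+ (M ℕ.+ k) - + (M ℕ.+ k))
      ≡⟨ solve 2 (λ x y → x :+ con (+ 20) :* (y :- y) := x) ≡.refl (+ 20 * + b + quad (+ suc d) (Int.suc j)) (+ (M ℕ.+ k)) ⟩
    + 20 * + b + quad (+ suc d) (Int.suc j)
      ≡⟨ ≡.cong (_+ quad (+ suc d) (Int.suc j)) (ℤₚ.pos-* 20 b) ⟨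
    + (20 ℕ.* b) + quad (+ suc d) (Int.suc j) ∎
    where
    open ≡.≡-Reasoning
    j = + a - + M

  down-exponent : ∀ d d′ k a b → d ℕ.+ d′ ≡ 18 → a ℕ.+ b ≡ k →
    + (suc d′ ℕ.+ k ℕ.* 20) + quad (+ suc d) (- + a) ≡ + (20 ℕ.* b) + quad (+ suc d) (- + suc a)
  down-exponent d d′ k a b eq ≡.refl = begin
    + suc d′ + + ((a ℕ.+ b) ℕ.* 20) + quad (+ suc d) (- + a)
      ≡⟨ ≡.cong₂ (λ x y → + suc d′ + x + quad (+ suc d) y) (ℤₚ.pos-* (a ℕ.+ b) 20) (≡.sym (suc-neg a)) ⟩
    + suc d′ + (+ a + + b) * + 20 + quad (+ suc d) (Int.suc j)
      ≡⟨ ≡.cong (λ x → + suc d′ + (+ a + + b) * + 20 + x) (quad-suc (+ suc d) j) ⟩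
    + suc d′ + (+ a + + b) * + 20 + (quad (+ suc d) j + (+ 20 * j + + suc d))
      ≡⟨ solve 5 (λ d d′ a b e → con 1ℤ :+ d′ :+ (a :+ b) :* con (+ 20) :+ (e :+ (con (+ 20) :* (:- (con 1ℤ :+ a)) :+ (con 1ℤ :+ d)))
           := con (+ 20) :* b :+ e :+ (d :+ d′ :- con (+ 18))) ≡.refl (+ d) (+ d′) (+ a) (+ b) (quad (+ suc d) j) ⟩
    + 20 * + b + quad (+ suc d) j + (+ (d ℕ.+ d′) - + 18)
      ≡⟨ ≡.cong (λ x → + 20 * + b + quad (+ suc d) j + (+ x - + 18)) eq ⟩
    + 20 * + b + quad (+ suc d) j + 0ℤ
      ≡⟨ ℤₚ.+-identityʳ _ ⟩
    + 20 * + b + quad (+ suc d) j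
      ≡⟨ ≡.cong (_+ quad (+ suc d) j) (ℤₚ.pos-* 20 b) ⟨
    + (20 ℕ.* b) + quad (+ suc d) j ∎
    where
    open ≡.≡-Reasoning
    j = - + suc a

  sub-antidiagonal : ∀ a b L → a ℕ.+ b ≡ L → + a - + L ≡ - + b
  sub-antidiagonal a b L ≡.refl = solve 2 (λ a b → a :- (a :+ b) := :- b) ≡.refl (+ a) (+ b)

  far-left : ∀ {N L} a → a ≤ N → N ℕ.+ N ≤ L → N ≤ ∣ + a - + L ∣
  far-left {N} {L} a a≤N 2N≤L = ≡.subst (N ≤_)
    (≡.sym (≡.trans (≡.cong ∣_∣ (ℤₚ.m-n≡m⊖n a L)) (ℤₚ.∣⊖∣-≤ (ℕₚ.≤-trans a≤N (ℕₚ.≤-trans (ℕₚ.m≤m+n N N) 2N≤L)))))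
    (ℕₚ.m+n≤o⇒m≤o∸n N (ℕₚ.≤-trans (ℕₚ.+-monoʳ-≤ N a≤N) 2N≤L))

  far-right : ∀ {N L} a b → a ℕ.+ b ≡ L ℕ.+ L → b ≤ N → N ℕ.+ N ≤ L → N ≤ ∣ + a - + L ∣
  far-right {N} {L} a b eq b≤N 2N≤L = ≡.subst (N ≤_) (≡.trans (ℤₚ.∣i-j∣≡∣j-i∣ (+ b) (+ L)) (≡.cong ∣_∣ flip-index)) (far-left b b≤N 2N≤L)
    where
    flip-index : + L - + b ≡ + a - + L
    flip-index = ≡.trans (solve 2 (λ l b → l :- b := (l :+ l) :- b :- l) ≡.refl (+ L) (+ b))
      (≡.trans (≡.cong (λ x → + x - + b - + L) (≡.sym eq)) (solve 3 (λ a b l → a :+ b :- b :- l := a :- l) ≡.refl (+ a) (+ b) (+ L)))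

  double-nonneg : ∀ {i} → 0ℤ Int.≤ i → 0ℤ Int.≤ i + i
  double-nonneg 0≤i = ℤₚ.+-mono-≤ 0≤i 0≤i

  -- For m = t + s and n = s - t the mixed terms of m² + n² cancel, so the exponent separates into a
  -- function of s and one of t. The extra `b` completes the latter to 20t² + (2t + 1)b.
  even-exponent : ∀ a b {c d} → c ≡ a + b → d ≡ a - b → ∀ s t →
    b + (quad c (t + s) + quad d (s - t)) ≡ quad a s + quad a s + (quad (+ 10 + b) t + quad (+ 10 + b) t + b)
  even-exponent a b ≡.refl ≡.refl = solve 4 (λ a b s t →
    let quad = λ c j → con (+ 10) :* (j :* (j :- con 1ℤ)) :+ c :* j in
    b :+ (quad (a :+ b) (t :+ s) :+ quad (a :- b) (s :- t))
      := quad a s :+ quad a s :+ (quad (con (+ 10) :+ b) t :+ quad (con (+ 10) :+ b) t :+ b)) ≡.refl a b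

  -- With m one larger the two shapes change places: the part in s becomes 20s² + (2s + 1)a, and the
  -- part in t is a doubled `quad b` at t + 1. The same extra `b` on the left makes both cases fit.
  odd-exponent : ∀ a b {c d} → c ≡ a + b → d ≡ a - b → ∀ s t →
    b + (quad c (t + Int.suc s) + quad d (s - t)) ≡
      quad (+ 10 + a) s + quad (+ 10 + a) s + a + (quad b (Int.suc t) + quad b (Int.suc t))
  odd-exponent a b ≡.refl ≡.refl = solve 4 (λ a b s t →
    let quad = λ c j → con (+ 10) :* (j :* (j :- con 1ℤ)) :+ c :* j in
    b :+ (quad (a :+ b) (t :+ (con 1ℤ :+ s)) :+ quad (a :- b) (s :- t))
      := quad (con (+ 10) :+ a) s :+ quad (con (+ 10) :+ a) s :+ a
         :+ (quad b (con 1ℤ :+ t) :+ quad b (con 1ℤ :+ t))) ≡.refl a b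

-- Commutative rings with a nilpotent element q

module Nilpotent (R : CommutativeRing 0ℓ 0ℓ) (constants : Int.+-*-rawRing -Raw-AlmostCommutative⟶ fromCommutativeRing R) (q : CommutativeRing.Carrier R) (N : ℕ) (q^N≈0 : CommutativeRing._≈_ R (Algebra.Properties.Semiring.Exp._^_ (CommutativeRing.semiring R) q N) (CommutativeRing.0# R)) where

  open CommutativeRing R
  open Integers
  open Algebra.Properties.Ring ring using (-‿involutive; -0#≈0#)
  open Algebra.Properties.Semiring.Exp semiring using (_^_; ^-homo-*; ^-assocʳ)
  open Algebra.Properties.CommutativeSemigroup *-commutativeSemigroup using (interchange; x∙yz≈y∙xz)
  open Relation.Binary.Reasoning.Setoid setoid
  open _-Raw-AlmostCommutative⟶_ constants using (⟦_⟧)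

  ⟦⟧-weaklyDecidable : ∀ a b → Maybe (⟦ a ⟧ ≈ ⟦ b ⟧)
  ⟦⟧-weaklyDecidable a b = Maybe.map (λ eq → reflexive (≡.cong ⟦_⟧ eq)) (dec⇒maybe (a ℤₚ.≟ b))

  module Solver = Algebra.Solver.Ring Int.+-*-rawRing (fromCommutativeRing R) constants
    ⟦⟧-weaklyDecidable

  -- The solver reads con 1ℤ as ⟦ 1ℤ ⟧, which is only provably equal to 1#.
  :1 : ∀ {n} → Solver.Polynomial n
  :1 = Solver._:^_ (Solver.con Int.1ℤ) 0

  q^≈0 : ∀ {n} → N ≤ n → q ^ n ≈ 0#
  q^≈0 {n} N≤n = begin
    q ^ n                     ≡⟨ ≡.cong (q ^_) (≡.sym (ℕₚ.m+[n∸m]≡n N≤n)) ⟩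
    q ^ (N ℕ.+ (n ℕ.∸ N))     ≈⟨ ^-homo-* q N _ ⟩
    q ^ N * q ^ (n ℕ.∸ N)     ≈⟨ *-congʳ q^N≈0 ⟩
    0# * q ^ (n ℕ.∸ N)        ≈⟨ zeroˡ _ ⟩
    0# ∎

  Unit : Carrier → Set
  Unit x = ∃ λ y → y * x ≈ 1#

  unit-* : ∀ {x y} → Unit x → Unit y → Unit (x * y)
  unit-* {x} {y} (x′ , p) (y′ , r) = x′ * y′ , trans (interchange x′ y′ x y) (trans (*-cong p r) (*-identityˡ 1#))

  unit-cancel : ∀ {u x y} → Unit u → u * x ≈ u * y → x ≈ y
  unit-cancel {u} {x} {y} (v , p) r = begin
    x             ≈⟨ *-identityˡ x ⟨
    1# * x        ≈⟨ *-congʳ p ⟨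
    v * u * x     ≈⟨ *-assoc v u x ⟩
    v * (u * x)   ≈⟨ *-congˡ r ⟩
    v * (u * y)   ≈⟨ *-assoc v u y ⟨
    v * u * y     ≈⟨ *-congʳ p ⟩
    1# * y        ≈⟨ *-identityˡ y ⟩
    y ∎

  geometric : Carrier → ℕ → Carrier
  geometric x zero = 0#
  geometric x (suc n) = 1# + x * geometric x n

  geometric-sum : ∀ x n → geometric x n * (1# - x) ≈ 1# - x ^ n
  geometric-sum x zero = trans (zeroˡ _) (sym (-‿inverseʳ 1#))
  geometric-sum x (suc n) = begin
    (1# + x * geometric x n) * (1# - x)
      ≈⟨ solve 2 (λ x g → (:1 :+ x :* g) :* (:1 :- x) := (:1 :- x) :+ x :* (g :* (:1 :- x))) refl x (geometric x n) ⟩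
    (1# - x) + x * (geometric x n * (1# - x))
      ≈⟨ +-congˡ (*-congˡ (geometric-sum x n)) ⟩
    (1# - x) + x * (1# - x ^ n)
      ≈⟨ solve 2 (λ x g → (:1 :- x) :+ x :* (:1 :- g) := :1 :- x :* g) refl x (x ^ n) ⟩
    1# - x * x ^ n ∎
    where
    open Solver

  unit-1-q^ : ∀ k → Unit (1# - q ^ suc k)
  unit-1-q^ k = geometric (q ^ suc k) N , (begin
    geometric (q ^ suc k) N * (1# - q ^ suc k)   ≈⟨ geometric-sum (q ^ suc k) N ⟩
    1# - (q ^ suc k) ^ N                         ≈⟨ +-congˡ (-‿cong vanish) ⟩
    1# - 0#                                      ≈⟨ trans (+-congˡ -0#≈0#) (+-identityʳ 1#) ⟩
    1# ∎)
    where
    vanish : (q ^ suc k) ^ N ≈ 0#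
    vanish = trans (^-assocʳ q (suc k) N) (q^≈0 (ℕₚ.m≤m+n N (k ℕ.* N)))

  -- Finite products over arithmetic progressions of exponents

  ∏ : ℕ → (ℕ → Carrier) → Carrier
  ∏ zero f = 1#
  ∏ (suc n) f = ∏ n f * f n

  ∏-cong : ∀ n {f g} → (∀ k → f k ≈ g k) → ∏ n f ≈ ∏ n g
  ∏-cong zero p = refl
  ∏-cong (suc n) p = *-cong (∏-cong n p) (p n)

  ∏-* : ∀ n f g → ∏ n f * ∏ n g ≈ ∏ n (λ k → f k * g k)
  ∏-* zero f g = *-identityˡ 1#
  ∏-* (suc n) f g = trans (interchange _ _ _ _) (*-congʳ (∏-* n f g))

  ∏-stable : ∀ m n {f} → (∀ k → m ≤ k → f k ≈ 1#) → ∏ (n ℕ.+ m) f ≈ ∏ m f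
  ∏-stable m zero p = refl
  ∏-stable m (suc n) p = trans (*-cong (∏-stable m n p) (p _ (ℕₚ.m≤n+m m n))) (*-identityʳ _)

  ∏-stable-≤ : ∀ {m n} {f} → (∀ k → m ≤ k → f k ≈ 1#) → m ≤ n → ∏ n f ≈ ∏ m f
  ∏-stable-≤ {m} {n} {f} p m≤n = trans (reflexive (≡.cong (λ l → ∏ l f) (≡.sym (ℕₚ.m∸n+n≡m m≤n)))) (∏-stable m (n ℕ.∸ m) p)

  1-q^≈1 : ∀ u {n} → N ≤ n → 1# + u * q ^ n ≈ 1#
  1-q^≈1 u N≤n = trans (+-congˡ (trans (*-congˡ (q^≈0 N≤n)) (zeroʳ u))) (+-identityʳ 1#)

  ∏-+ : ∀ m n f → ∏ (m ℕ.+ n) f ≈ ∏ m (λ i → f (i ℕ.+ n)) * ∏ n f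
  ∏-+ zero n f = sym (*-identityˡ _)
  ∏-+ (suc m) n f = trans (*-congʳ (∏-+ m n f))
    (solve 3 (λ a b c → a :* b :* c := a :* c :* b) refl _ _ _)
    where open Solver

  ∏-blocks : ∀ n m f → ∏ (n ℕ.* m) f ≈ ∏ n (λ k → ∏ m (λ i → f (i ℕ.+ k ℕ.* m)))
  ∏-blocks zero m f = refl
  ∏-blocks (suc n) m f = trans (∏-+ m (n ℕ.* m) f) (trans (*-comm _ _) (*-congʳ (∏-blocks n m f)))

  ∏-unit : ∀ n {f} → (∀ k → Unit (f k)) → Unit (∏ n f)
  ∏-unit zero p = 1# , *-identityˡ 1#
  ∏-unit (suc n) p = unit-* (∏-unit n p) (p n)

  ∏-ones : ∀ n → ∏ n (λ _ → 1#) ≈ 1#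
  ∏-ones zero = refl
  ∏-ones (suc n) = trans (*-identityʳ _) (∏-ones n)

  -- The residues are shifted by one, so that the exponents are positive for every i.
  progression : Carrier → ℕ → ℕ → ℕ → Carrier
  progression u i m n = ∏ n (λ k → 1# + u * q ^ (suc i ℕ.+ k ℕ.* m))

  progression-cong : ∀ {u u′} i m n → u ≈ u′ → progression u i m n ≈ progression u′ i m n
  progression-cong i m n p = ∏-cong n (λ k → +-congˡ (*-congʳ p))

  progression-stable : ∀ u i m {n} → N ≤ n → progression u i (suc m) n ≈ progression u i (suc m) N
  progression-stable u i m = ∏-stable-≤ (λ k N≤k → 1-q^≈1 u
    (ℕₚ.≤-trans N≤k (ℕₚ.≤-trans (ℕₚ.m≤m*n k (suc m)) (ℕₚ.m≤n+m (k ℕ.* suc m) (suc i)))))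

  progression-split : ∀ u i m n → progression u i m (n ℕ.+ n) ≈ progression u i (m ℕ.+ m) n * progression u (i ℕ.+ m) (m ℕ.+ m) n
  progression-split u i m zero = sym (*-identityˡ 1#)
  progression-split u i m (suc n) = begin
    progression u i m (suc n ℕ.+ suc n)
      ≡⟨ ≡.cong (λ l → progression u i m (suc l)) (ℕₚ.+-suc n n) ⟩
    progression u i m (n ℕ.+ n) * h (suc i ℕ.+ (n ℕ.+ n) ℕ.* m) * h (suc i ℕ.+ suc (n ℕ.+ n) ℕ.* m)
      ≈⟨ *-cong (*-cong (progression-split u i m n) (reflexive (≡.cong h (even n)))) (reflexive (≡.cong h (odd n))) ⟩
    progression u i (m ℕ.+ m) n * progression u (i ℕ.+ m) (m ℕ.+ m) n * h (suc i ℕ.+ n ℕ.* (m ℕ.+ m)) * h (suc (i ℕ.+ m) ℕ.+ n ℕ.* (m ℕ.+ m))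
      ≈⟨ trans (*-assoc _ _ _) (interchange _ _ _ _) ⟩
    progression u i (m ℕ.+ m) (suc n) * progression u (i ℕ.+ m) (m ℕ.+ m) (suc n) ∎
    where
    h : ℕ → Carrier
    h e = 1# + u * q ^ e
    module S = Data.Nat.Solver.+-*-Solver
    even : ∀ n → suc i ℕ.+ (n ℕ.+ n) ℕ.* m ≡ suc i ℕ.+ n ℕ.* (m ℕ.+ m)
    even n = S.solve 3 (λ i n m → (S.con 1 S.:+ i) S.:+ (n S.:+ n) S.:* m S.:= (S.con 1 S.:+ i) S.:+ n S.:* (m S.:+ m)) ≡.refl i n m
    odd : ∀ n → suc i ℕ.+ suc (n ℕ.+ n) ℕ.* m ≡ suc (i ℕ.+ m) ℕ.+ n ℕ.* (m ℕ.+ m)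
    odd n = S.solve 3 (λ i n m → (S.con 1 S.:+ i) S.:+ (S.con 1 S.:+ (n S.:+ n)) S.:* m S.:= (S.con 1 S.:+ (i S.:+ m)) S.:+ n S.:* (m S.:+ m)) ≡.refl i n m

  progression-square : ∀ i m n → progression 1# i m n * progression (- 1#) i m n ≈ progression (- 1#) (suc (i ℕ.+ i)) (m ℕ.+ m) n
  progression-square i m n = trans (∏-* n _ _) (∏-cong n (λ k → begin
    (1# + 1# * q ^ (suc i ℕ.+ k ℕ.* m)) * (1# + - 1# * q ^ (suc i ℕ.+ k ℕ.* m))
      ≈⟨ solve 1 (λ x → (:1 :+ :1 :* x) :* (:1 :+ :- :1 :* x) := :1 :+ :- :1 :* (x :* x)) refl (q ^ (suc i ℕ.+ k ℕ.* m)) ⟩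
    1# + - 1# * (q ^ (suc i ℕ.+ k ℕ.* m) * q ^ (suc i ℕ.+ k ℕ.* m))
      ≈⟨ +-congˡ (*-congˡ (trans (sym (^-homo-* q (suc i ℕ.+ k ℕ.* m) _)) (reflexive (≡.cong (q ^_) (exponent k))))) ⟩
    1# + - 1# * q ^ (suc (suc (i ℕ.+ i)) ℕ.+ k ℕ.* (m ℕ.+ m)) ∎))
    where
    open Solver
    module S = Data.Nat.Solver.+-*-Solver
    exponent : ∀ k → (suc i ℕ.+ k ℕ.* m) ℕ.+ (suc i ℕ.+ k ℕ.* m) ≡ suc (suc (i ℕ.+ i)) ℕ.+ k ℕ.* (m ℕ.+ m)
    exponent k = S.solve 3 (λ i k m → (S.con 1 S.:+ i S.:+ k S.:* m) S.:+ (S.con 1 S.:+ i S.:+ k S.:* m) S.:= (S.con 2 S.:+ (i S.:+ i)) S.:+ k S.:* (m S.:+ m)) ≡.refl i k m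

  -- Antidiagonal sums and Gaussian binomial coefficients

  AD : (ℕ → ℕ → Carrier) → ℕ → ℕ → Carrier
  AD f i zero = f i 0
  AD f i (suc j) = f i (suc j) + AD f (suc i) j

  AD-cong : ∀ {f g} i j → (∀ a b → a ℕ.+ b ≡ i ℕ.+ j → f a b ≈ g a b) → AD f i j ≈ AD g i j
  AD-cong i zero p = p i 0 ≡.refl
  AD-cong i (suc j) p = +-cong (p i (suc j) ≡.refl)
    (AD-cong (suc i) j (λ a b eq → p a b (≡.trans eq (≡.sym (ℕₚ.+-suc i j)))))

  AD-shift : ∀ f i j → AD f (suc i) j ≈ AD (λ a b → f (suc a) b) i j
  AD-shift f i zero = refl
  AD-shift f i (suc j) = +-congˡ (AD-shift f (suc i) j)

  AD-snoc : ∀ f i j → AD f i (suc j) ≈ AD (λ a b → f a (suc b)) i j + f (suc (j ℕ.+ i)) 0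
  AD-snoc f i zero = refl
  AD-snoc f i (suc j) = trans
    (+-congˡ (trans (AD-snoc f (suc i) j) (+-congˡ (reflexive (≡.cong (λ a → f (suc a) 0) (ℕₚ.+-suc j i))))))
    (sym (+-assoc _ _ _))

  AD-flip : ∀ f n → AD f 0 n ≈ AD (flip f) 0 n
  AD-flip f zero = refl
  AD-flip f (suc n) = begin
    AD f 0 (suc n)                                            ≈⟨ AD-snoc f 0 n ⟩
    AD (λ a b → f a (suc b)) 0 n + f (suc (n ℕ.+ 0)) 0        ≈⟨ +-cong (AD-flip (λ a b → f a (suc b)) n) (reflexive (≡.cong (λ a → f (suc a) 0) (ℕₚ.+-identityʳ n))) ⟩
    AD (λ a b → f b (suc a)) 0 n + f (suc n) 0                ≈⟨ +-comm _ _ ⟩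
    f (suc n) 0 + AD (λ a b → f b (suc a)) 0 n                ≈⟨ +-congˡ (AD-shift (flip f) 0 n) ⟨
    f (suc n) 0 + AD (flip f) 1 n ∎

  AD-scale : ∀ w f i j → w * AD f i j ≈ AD (λ a b → w * f a b) i j
  AD-scale w f i zero = refl
  AD-scale w f i (suc j) = trans (distribˡ w _ _) (+-congˡ (AD-scale w f (suc i) j))

  Q : ℕ → Carrier
  Q k = q ^ (20 ℕ.* k)

  Q-+ : ∀ j k → Q j * Q k ≈ Q (j ℕ.+ k)
  Q-+ j k = trans (sym (^-homo-* q (20 ℕ.* j) (20 ℕ.* k))) (reflexive (≡.cong (q ^_) (≡.sym (ℕₚ.*-distribˡ-+ 20 j k))))

  euler : ℕ → Carrier
  euler n = ∏ n (λ k → 1# - Q (suc k))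

  1-Q⁻¹ : ℕ → Carrier
  1-Q⁻¹ k = proj₁ (unit-1-q^ (19 ℕ.+ 20 ℕ.* k))

  1-Q-unit : ∀ k → 1-Q⁻¹ k * (1# - Q (suc k)) ≈ 1#
  1-Q-unit k = trans (*-congˡ (+-congˡ (-‿cong (reflexive (≡.cong (q ^_) (ℕₚ.*-suc 20 k))))))
    (proj₂ (unit-1-q^ (19 ℕ.+ 20 ℕ.* k)))

  euler⁻¹ : ℕ → Carrier
  euler⁻¹ n = ∏ n 1-Q⁻¹

  euler-unit : ∀ n → euler⁻¹ n * euler n ≈ 1#
  euler-unit n = trans (∏-* n _ _) (trans (∏-cong n 1-Q-unit) (∏-ones n))

  euler⁻¹-suc : ∀ n → euler⁻¹ (suc n) * (1# - Q (suc n)) ≈ euler⁻¹ n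
  euler⁻¹-suc n = trans (*-assoc _ _ _) (trans (*-congˡ (1-Q-unit n)) (*-identityʳ _))

  -- The Gaussian binomial coefficient with upper entry i + j and lower entry i, to base q²⁰.
  binomial : ℕ → ℕ → Carrier
  binomial i j = euler (i ℕ.+ j) * (euler⁻¹ i * euler⁻¹ j)

  binomial-sym : ∀ i j → binomial i j ≈ binomial j i
  binomial-sym i j = *-cong (reflexive (≡.cong euler (ℕₚ.+-comm i j))) (*-comm _ _)

  binomial-0ʳ : ∀ i → binomial i 0 ≈ 1#
  binomial-0ʳ i = trans (*-cong (reflexive (≡.cong euler (ℕₚ.+-identityʳ i))) (*-identityʳ _)) (trans (*-comm _ _) (euler-unit i))

  binomial-0ˡ : ∀ j → binomial 0 j ≈ 1#
  binomial-0ˡ j = trans (binomial-sym 0 j) (binomial-0ʳ j)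

  -- With x = `Q (suc i)` and y = `Q (suc j)` this is 1 - xy = (1 - y) + y(1 - x), multiplied by the
  -- Euler products.
  pascal : ∀ i j → binomial (suc i) (suc j) ≈ binomial (suc i) j + Q (suc j) * binomial i (suc j)
  pascal i j = begin
    euler (suc i ℕ.+ suc j) * (I * J)
      ≈⟨ *-congʳ (trans (reflexive (≡.cong euler (ℕₚ.+-suc (suc i) j))) (*-congˡ (+-congˡ (-‿cong q-split)))) ⟩
    E * (1# - x * y) * (I * J)
      ≈⟨ solve 5 (λ E x y I J → E :* (:1 :- x :* y) :* (I :* J) := E :* (I :* (J :* (:1 :- y))) :+ y :* (E :* ((I :* (:1 :- x)) :* J))) refl E x y I J ⟩
    E * (I * (J * (1# - y))) + y * (E * (I * (1# - x) * J))
      ≈⟨ +-cong (*-congˡ (*-congˡ (euler⁻¹-suc j))) (*-congˡ (*-cong (reflexive (≡.cong euler (≡.sym (ℕₚ.+-suc i j)))) (*-congʳ (euler⁻¹-suc i)))) ⟩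
    binomial (suc i) j + y * binomial i (suc j) ∎
    where
    open Solver
    E = euler (suc i ℕ.+ j)
    I = euler⁻¹ (suc i)
    J = euler⁻¹ (suc j)
    x = Q (suc i)
    y = Q (suc j)
    q-split : Q (suc (suc i ℕ.+ j)) ≈ x * y
    q-split = trans (reflexive (≡.cong Q (≡.sym (ℕₚ.+-suc (suc i) j)))) (sym (Q-+ (suc i) (suc j)))

  -- The hypothesis moves `w` times each term onto its successor, where `pascal` adds the two
  -- coefficients. To allow induction on `j` the sum may start at any `i`; the first term of the
  -- result keeps the coefficient `binomial i j`, because no predecessor at i - 1 contributes to it.
  binomial-step : ∀ w (τ : ℕ → Carrier) i j →
    (∀ a b → a ℕ.+ b ≡ i ℕ.+ j → w * τ a ≈ - (Q b * τ (suc a))) →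
    (1# - w) * AD (λ a b → binomial a b * τ a) i j ≈ binomial i j * τ i + AD (λ a b → binomial a b * τ a) (suc i) j
  binomial-step w τ i zero hyp = begin
    (1# - w) * (binomial i 0 * τ i)
      ≈⟨ solve 3 (λ w b t → (:1 :- w) :* (b :* t) := b :* t :- b :* (w :* t)) refl w (binomial i 0) (τ i) ⟩
    binomial i 0 * τ i - binomial i 0 * (w * τ i)
      ≈⟨ +-congˡ (-‿cong (*-congˡ (trans (hyp i 0 ≡.refl) (-‿cong (*-identityˡ _))))) ⟩
    binomial i 0 * τ i - binomial i 0 * - τ (suc i)
      ≈⟨ solve 3 (λ x b s → x :- b :* (:- s) := x :+ b :* s) refl _ (binomial i 0) (τ (suc i)) ⟩
    binomial i 0 * τ i + binomial i 0 * τ (suc i)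
      ≈⟨ +-congˡ (*-congʳ (trans (binomial-0ʳ i) (sym (binomial-0ʳ (suc i))))) ⟩
    binomial i 0 * τ i + binomial (suc i) 0 * τ (suc i) ∎
    where open Solver
  binomial-step w τ i (suc j) hyp = begin
    (1# - w) * (b * t + AD g (suc i) j)
      ≈⟨ solve 4 (λ w b t A → (:1 :- w) :* (b :* t :+ A) := b :* t :- b :* (w :* t) :+ (:1 :- w) :* A) refl w b t (AD g (suc i) j) ⟩
    b * t - b * (w * t) + (1# - w) * AD g (suc i) j
      ≈⟨ +-cong (+-congˡ (-‿cong (*-congˡ (hyp i (suc j) ≡.refl))))
           (binomial-step w τ (suc i) j (λ a c eq → hyp a c (≡.trans eq (≡.sym (ℕₚ.+-suc i j))))) ⟩
    b * t - b * - (Q (suc j) * t′) + (binomial (suc i) j * t′ + AD g (suc (suc i)) j)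
      ≈⟨ solve 6 (λ x b y t c A → x :- b :* (:- (y :* t)) :+ (c :* t :+ A) := x :+ ((c :+ y :* b) :* t :+ A)) refl
           (b * t) b (Q (suc j)) t′ (binomial (suc i) j) (AD g (suc (suc i)) j) ⟩
    b * t + ((binomial (suc i) j + Q (suc j) * b) * t′ + AD g (suc (suc i)) j)
      ≈⟨ +-congˡ (+-congʳ (*-congʳ (pascal i j))) ⟨
    b * t + (binomial (suc i) (suc j) * t′ + AD g (suc (suc i)) j) ∎
    where
    open Solver
    g = λ a c → binomial a c * τ a
    b = binomial i (suc j)
    t = τ i
    t′ = τ (suc i)

  -- One step of the q-binomial theorem: for a sum that starts at 0 the leading coefficients
  -- `binomial 0 n` and `binomial 0 (suc n)` are both 1, so the result of `binomial-step` is again a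
  -- full sum.
  binomial-sum-suc : ∀ w (τ : ℕ → Carrier) n →
    (∀ a b → a ℕ.+ b ≡ n → w * τ a ≈ - (Q b * τ (suc a))) →
    AD (λ a b → binomial a b * τ a) 0 (suc n) ≈ AD (λ a b → binomial a b * τ a) 0 n * (1# - w)
  binomial-sum-suc w τ n hyp = sym (trans (*-comm _ _) (trans (binomial-step w τ 0 n hyp)
    (+-congʳ (*-congʳ (trans (binomial-0ˡ n) (sym (binomial-0ˡ (suc n))))))))

  Q≈0 : ∀ {k} → N ≤ k → Q k ≈ 0#
  Q≈0 {k} N≤k = q^≈0 (ℕₚ.≤-trans N≤k (ℕₚ.m≤n*m k 20))

  E∞ : Carrier
  E∞ = euler N

  euler-stable : ∀ {n} → N ≤ n → euler n ≈ E∞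
  euler-stable = ∏-stable-≤ (λ k N≤k → trans (+-congˡ (-‿cong (Q≈0 (ℕₚ.m≤n⇒m≤1+n N≤k)))) (trans (+-congˡ -0#≈0#) (+-identityʳ 1#)))

  E∞-unit : Unit E∞
  E∞-unit = euler⁻¹ N , euler-unit N

  E∞*euler⁻¹ : ∀ {n} → N ≤ n → E∞ * euler⁻¹ n ≈ 1#
  E∞*euler⁻¹ {n} N≤n = trans (*-comm _ _) (trans (*-congˡ (sym (euler-stable N≤n))) (euler-unit n))

  -- From `N` on all Euler products equal `E∞`, so the binomial has the value E∞ / (E∞ E∞).
  binomial-limit : ∀ {i j} → N ≤ i → N ≤ j → E∞ * binomial i j ≈ 1#
  binomial-limit {i} {j} N≤i N≤j = begin
    E∞ * (euler (i ℕ.+ j) * (euler⁻¹ i * euler⁻¹ j))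
      ≈⟨ *-congˡ (*-congʳ (euler-stable (ℕₚ.≤-trans N≤i (ℕₚ.m≤m+n i j)))) ⟩
    E∞ * (E∞ * (euler⁻¹ i * euler⁻¹ j))
      ≈⟨ solve 3 (λ E I J → E :* (E :* (I :* J)) := (E :* I) :* (E :* J)) refl E∞ (euler⁻¹ i) (euler⁻¹ j) ⟩
    (E∞ * euler⁻¹ i) * (E∞ * euler⁻¹ j)
      ≈⟨ *-cong (E∞*euler⁻¹ N≤i) (E∞*euler⁻¹ N≤j) ⟩
    1# * 1#  ≈⟨ *-identityˡ 1# ⟩
    1# ∎
    where open Solver

  -- Symmetric finite sums standing for bilateral series

  Z : ℕ → (ℤ → Carrier) → Carrier
  Z zero f = f (+ 0)
  Z (suc L) f = Z L f + (f (+ suc L) + f -[1+ L ])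

  Z-cong : ∀ L {f g} → (∀ j → f j ≈ g j) → Z L f ≈ Z L g
  Z-cong zero p = p (+ 0)
  Z-cong (suc L) p = +-cong (Z-cong L p) (+-cong (p _) (p _))

  Z-zero : ∀ L {f} → (∀ j → f j ≈ 0#) → Z L f ≈ 0#
  Z-zero zero p = p _
  Z-zero (suc L) p = trans (+-cong (Z-zero L p) (trans (+-cong (p _) (p _)) (+-identityˡ 0#))) (+-identityˡ 0#)

  Z-+ : ∀ L f g → Z L (λ j → f j + g j) ≈ Z L f + Z L g
  Z-+ zero f g = refl
  Z-+ (suc L) f g = trans (+-congʳ (Z-+ L f g))
    (solve 6 (λ a b c d e h → (a :+ b) :+ ((c :+ d) :+ (e :+ h)) := (a :+ (c :+ e)) :+ (b :+ (d :+ h))) refl _ _ _ _ _ _)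
    where open Solver

  Z-scaleˡ : ∀ L x f → Z L (λ j → x * f j) ≈ x * Z L f
  Z-scaleˡ zero x f = refl
  Z-scaleˡ (suc L) x f = trans (+-congʳ (Z-scaleˡ L x f))
    (solve 4 (λ x a b c → x :* a :+ (x :* b :+ x :* c) := x :* (a :+ (b :+ c))) refl _ _ _ _)
    where open Solver

  Z-scaleʳ : ∀ L x f → Z L (λ j → f j * x) ≈ Z L f * x
  Z-scaleʳ L x f = trans (Z-cong L (λ j → *-comm (f j) x)) (trans (Z-scaleˡ L x f) (*-comm x _))

  Z-swap : ∀ L M (f : ℤ → ℤ → Carrier) → Z L (λ i → Z M (f i)) ≈ Z M (λ j → Z L (λ i → f i j))
  Z-swap zero M f = refl
  Z-swap (suc L) M f = begin
    Z L (λ i → Z M (f i)) + (Z M (f (+ suc L)) + Z M (f -[1+ L ]))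
      ≈⟨ +-cong (Z-swap L M f) (sym (Z-+ M (f (+ suc L)) (f -[1+ L ]))) ⟩
    Z M (λ j → Z L (λ i → f i j)) + Z M (λ j → f (+ suc L) j + f -[1+ L ] j)
      ≈⟨ Z-+ M _ _ ⟨
    Z M (λ j → Z (suc L) (λ i → f i j)) ∎

  AD-Z : ∀ L (f : ℤ → Carrier) → AD (λ i _ → f (+ i Int.- + L)) 0 (L ℕ.+ L) ≈ Z L f
  AD-Z zero f = refl
  AD-Z (suc L) f = begin
    AD g 0 (suc (L ℕ.+ suc L))
      ≈⟨ reflexive (≡.cong (λ n → AD g 0 (suc n)) (ℕₚ.+-suc L L)) ⟩
    g 0 0 + AD g 1 (suc (L ℕ.+ L))
      ≈⟨ +-congˡ (trans (AD-shift g 0 (suc (L ℕ.+ L))) (AD-snoc (λ a b → g (suc a) b) 0 (L ℕ.+ L))) ⟩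
    f -[1+ L ] + (AD (λ a b → g (suc a) (suc b)) 0 (L ℕ.+ L) + g (suc (suc (L ℕ.+ L ℕ.+ 0))) 0)
      ≈⟨ +-congˡ (+-cong (trans (AD-cong 0 (L ℕ.+ L) (λ a b _ → reflexive (≡.cong f (suc-sub-suc a L)))) (AD-Z L f))
           (reflexive (≡.cong f (last-index L)))) ⟩
    f -[1+ L ] + (Z L f + f (+ suc L))
      ≈⟨ solve 3 (λ a b c → a :+ (b :+ c) := b :+ (c :+ a)) refl _ _ _ ⟩
    Z L f + (f (+ suc L) + f -[1+ L ]) ∎
    where
    open Solver
    g = λ (i _ : ℕ) → f (+ i Int.- + suc L)

  Supported : ℕ → (ℤ → Carrier) → Set
  Supported K f = ∀ j → K ≤ ∣ j ∣ → f j ≈ 0#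

  Z-stable : ∀ {K} n {f} → Supported K f → Z (n ℕ.+ K) f ≈ Z K f
  Z-stable zero sup = refl
  Z-stable {K} (suc n) sup = trans (+-cong (Z-stable n sup)
    (trans (+-cong (sup _ K≤) (sup _ K≤)) (+-identityˡ 0#))) (+-identityʳ _)
    where
    K≤ : K ≤ suc (n ℕ.+ K)
    K≤ = ℕₚ.m≤n⇒m≤1+n (ℕₚ.m≤n+m K n)

  Z-stable-≤ : ∀ {K L L′ f} → Supported K f → K ≤ L → K ≤ L′ → Z L f ≈ Z L′ f
  Z-stable-≤ {K} {L} {L′} {f} sup p p′ = trans (to p) (sym (to p′))
    where
    to : ∀ {L} → K ≤ L → Z L f ≈ Z K f
    to {L} p = trans (reflexive (≡.cong (λ l → Z l f) (≡.sym (ℕₚ.m∸n+n≡m p)))) (Z-stable (L ℕ.∸ K) sup)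

  Z-suc : ∀ L f → Z L (λ j → f (Int.suc j)) + f (Int.- (+ L)) ≈ Z L f + f (+ suc L)
  Z-suc zero f = +-comm _ _
  Z-suc (suc L) f = begin
    Z L (λ j → f (Int.suc j)) + (f (+ suc (suc L)) + f (Int.suc -[1+ L ])) + f -[1+ L ]
      ≈⟨ +-congʳ (+-congˡ (+-congˡ (reflexive (≡.cong f (suc-neg L))))) ⟩
    Z L (λ j → f (Int.suc j)) + (f (+ suc (suc L)) + f (Int.- (+ L))) + f -[1+ L ]
      ≈⟨ solve 4 (λ z a b c → z :+ (a :+ b) :+ c := (z :+ b) :+ (a :+ c)) refl _ _ _ _ ⟩
    (Z L (λ j → f (Int.suc j)) + f (Int.- (+ L))) + (f (+ suc (suc L)) + f -[1+ L ])
      ≈⟨ +-congʳ (Z-suc L f) ⟩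
    Z L f + f (+ suc L) + (f (+ suc (suc L)) + f -[1+ L ])
      ≈⟨ solve 4 (λ z a b c → z :+ a :+ (b :+ c) := z :+ (a :+ c) :+ b) refl _ _ _ _ ⟩
    Z L f + (f (+ suc L) + f -[1+ L ]) + f (+ suc (suc L)) ∎
    where
    open Solver

  Z-suc-supported : ∀ {K L f} → Supported K f → K ≤ L → Z L (λ j → f (Int.suc j)) ≈ Z L f
  Z-suc-supported {K} {L} {f} sup K≤L = begin
    Z L (λ j → f (Int.suc j))                       ≈⟨ +-identityʳ _ ⟨
    Z L (λ j → f (Int.suc j)) + 0#                  ≈⟨ +-congˡ (sup _ (≡.subst (K ≤_) (≡.sym (ℤₚ.∣-i∣≡∣i∣ (+ L))) K≤L)) ⟨
    Z L (λ j → f (Int.suc j)) + f (Int.- (+ L))     ≈⟨ Z-suc L f ⟩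
    Z L f + f (+ suc L)                             ≈⟨ +-congˡ (sup _ (ℕₚ.m≤n⇒m≤1+n K≤L)) ⟩
    Z L f + 0#                                      ≈⟨ +-identityʳ _ ⟩
    Z L f ∎

  Z-shift-+ : ∀ {K L f} s → Supported K f → K ℕ.+ s ≤ L → Z L (λ j → f (j Int.+ + s)) ≈ Z L f
  Z-shift-+ {L = L} {f} zero sup _ = Z-cong L (λ j → reflexive (≡.cong f (ℤₚ.+-identityʳ j)))
  Z-shift-+ {K} {L} {f} (suc s) sup K+s≤L = begin
    Z L (λ j → f (j Int.+ + suc s))        ≈⟨ Z-cong L (λ j → reflexive (≡.cong f (suc-+ j s))) ⟨
    Z L (λ j → f (Int.suc j Int.+ + s))    ≈⟨ Z-suc-supported {K ℕ.+ s} sup′ K+s≤L′ ⟩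
    Z L (λ j → f (j Int.+ + s))            ≈⟨ Z-shift-+ s sup K+s≤L′ ⟩
    Z L f ∎
    where
    K+s≤L′ : K ℕ.+ s ≤ L
    K+s≤L′ = ℕₚ.≤-trans (ℕₚ.+-monoʳ-≤ K (ℕₚ.n≤1+n s)) K+s≤L
    sup′ : Supported (K ℕ.+ s) (λ j → f (j Int.+ + s))
    sup′ j K+s≤j = sup _ (ℕₚ.+-cancelʳ-≤ s K _ (ℕₚ.≤-trans K+s≤j (∣i∣≤∣i+j∣+∣j∣ j (+ s))))

  -- The room of twice |s| is for negative `s`: the translated function has support bound K + |s|,
  -- and translating it back needs another |s|.
  Z-shift : ∀ {K L f} s → Supported K f → K ℕ.+ (∣ s ∣ ℕ.+ ∣ s ∣) ≤ L → Z L (λ j → f (j Int.+ s)) ≈ Z L f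
  Z-shift {K} (+ s) sup le = Z-shift-+ s sup (ℕₚ.≤-trans (ℕₚ.+-monoʳ-≤ K (ℕₚ.m≤m+n s s)) le)
  Z-shift {K} {L} {f} -[1+ s ] sup le = begin
    Z L (λ j → f (j Int.- + suc s))                      ≈⟨ Z-shift-+ (suc s) sup′ (≡.subst (_≤ L) (≡.sym (ℕₚ.+-assoc K (suc s) (suc s))) le) ⟨
    Z L (λ j → f (j Int.+ + suc s Int.- + suc s))        ≈⟨ Z-cong L (λ j → reflexive (≡.cong f (+-sub-cancel j (+ suc s)))) ⟩
    Z L f ∎
    where
    sup′ : Supported (K ℕ.+ suc s) (λ j → f (j Int.- + suc s))
    sup′ j K+s≤j = sup _ (ℕₚ.+-cancelʳ-≤ (suc s) K _ (ℕₚ.≤-trans K+s≤j (∣i∣≤∣i+j∣+∣j∣ j -[1+ s ])))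

  -- The odd numbers 2s + 1 with |s| ≤ L reach up to 2L + 1, one beyond the window of the even ones;
  -- hence the extra term on the left.
  Z-even-odd : ∀ L f → Z (L ℕ.+ L) f + f (+ suc (L ℕ.+ L)) ≈
    Z L (λ s → f (s Int.+ s)) + Z L (λ s → f (Int.suc (s Int.+ s)))
  Z-even-odd zero f = refl
  Z-even-odd (suc L) f rewrite ℕₚ.+-suc L L = begin
    Z (L ℕ.+ L) f + (f₁ + f -[1+ L ℕ.+ L ]) + (f₂ + f -[1+ suc (L ℕ.+ L) ]) + f (+ suc (suc (suc (L ℕ.+ L))))
      ≈⟨ solve 6 (λ z a b c d e → z :+ (a :+ b) :+ (c :+ d) :+ e := (z :+ a) :+ ((c :+ d) :+ (e :+ b))) refl _ _ _ _ _ _ ⟩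
    Z (L ℕ.+ L) f + f₁ + (f₂ + f -[1+ suc (L ℕ.+ L) ] + (f (+ suc (suc (suc (L ℕ.+ L)))) + f -[1+ L ℕ.+ L ]))
      ≈⟨ +-congʳ (Z-even-odd L f) ⟩
    Z L (λ s → f (s Int.+ s)) + Z L (λ s → f (Int.suc (s Int.+ s))) + (f₂ + f -[1+ suc (L ℕ.+ L) ] + (f (+ suc (suc (suc (L ℕ.+ L)))) + f -[1+ L ℕ.+ L ]))
      ≈⟨ solve 4 (λ a b c d → (a :+ b) :+ (c :+ d) := (a :+ c) :+ (b :+ d)) refl _ _ _ _ ⟩
    Z L (λ s → f (s Int.+ s)) + (f₂ + f -[1+ suc (L ℕ.+ L) ]) + (Z L (λ s → f (Int.suc (s Int.+ s))) + (f (+ suc (suc (suc (L ℕ.+ L)))) + f -[1+ L ℕ.+ L ])) ∎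
    where
    open Solver
    f₁ = f (+ suc (L ℕ.+ L))
    f₂ = f (+ suc (suc (L ℕ.+ L)))

  Z-parity : ∀ {K L f} → Supported K f → K ≤ L → Z L f ≈
    Z L (λ s → f (s Int.+ s)) + Z L (λ s → f (Int.suc (s Int.+ s)))
  Z-parity {K} {L} {f} sup K≤L = begin
    Z L f                                   ≈⟨ Z-stable-≤ sup K≤L K≤2L ⟩
    Z (L ℕ.+ L) f                           ≈⟨ +-identityʳ _ ⟨
    Z (L ℕ.+ L) f + 0#                      ≈⟨ +-congˡ (sup (+ suc (L ℕ.+ L)) (ℕₚ.m≤n⇒m≤1+n K≤2L)) ⟨
    Z (L ℕ.+ L) f + f (+ suc (L ℕ.+ L))     ≈⟨ Z-even-odd L f ⟩
    _ ∎
    where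
    K≤2L : K ≤ L ℕ.+ L
    K≤2L = ℕₚ.≤-trans K≤L (ℕₚ.m≤m+n L L)

  -- The substitution m = s + t, n = s - t on pairs of equal parity, m = s + t + 1, n = s - t on the others.
  Z-rotate : ∀ K L (f : ℤ → ℤ → Carrier) → (∀ m n → K ≤ ∣ m ∣ → f m n ≈ 0#) → (∀ m n → K ≤ ∣ n ∣ → f m n ≈ 0#) →
    K ℕ.+ (K ℕ.+ K) ≤ L →
    Z L (λ m → Z L (f m)) ≈
      Z L (λ s → Z L (λ t → f (t Int.+ s) (s Int.- t))) + Z L (λ s → Z L (λ t → f (t Int.+ Int.suc s) (s Int.- t)))
  Z-rotate K L f supₘ supₙ 3K≤L = begin
    Z L (λ m → Z L (f m))                                  ≈⟨ Z-cong L by-sum ⟩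
    Z L (λ m → Z L (λ σ → f m (σ Int.- m)))                ≈⟨ Z-swap L L _ ⟩
    Z L g                                                  ≈⟨ Z-parity (λ σ far → Z-zero L (λ m → diagonal σ m far)) (ℕₚ.≤-trans (ℕₚ.m≤n+m (K ℕ.+ K) K) 3K≤L) ⟩
    Z L (λ s → g (s Int.+ s)) + Z L (λ s → g (Int.suc (s Int.+ s)))
      ≈⟨ +-cong (Z-cong L even) (Z-cong L odd) ⟩
    _ ∎
    where
    room : ∀ s → ∣ s ∣ ≤ K → K ℕ.+ (∣ s ∣ ℕ.+ ∣ s ∣) ≤ L
    room s s≤K = ℕₚ.≤-trans (ℕₚ.+-monoʳ-≤ K (ℕₚ.+-mono-≤ s≤K s≤K)) 3K≤L
    g : ℤ → Carrier
    g σ = Z L (λ m → f m (σ Int.- m))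
    -- For |m| ≤ K a shift by -m fits into the window; for larger |m| it might not, but then both
    -- sums vanish term by term. `even` and `odd` distinguish the same two cases.
    by-sum : ∀ m → Z L (f m) ≈ Z L (λ σ → f m (σ Int.- m))
    by-sum m with ∣ m ∣ ℕ.≤? K
    ... | yes m≤K = sym (Z-shift (Int.- m) (supₙ m) (room (Int.- m) (≡.subst (_≤ K) (≡.sym (ℤₚ.∣-i∣≡∣i∣ m)) m≤K)))
    ... | no m≰K = trans (Z-zero L (λ n → supₘ m n K≤m)) (sym (Z-zero L (λ n → supₘ m _ K≤m)))
      where K≤m = ℕₚ.<⇒≤ (ℕₚ.≰⇒> m≰K)
    diagonal : ∀ σ m → K ℕ.+ K ≤ ∣ σ ∣ → f m (σ Int.- m) ≈ 0#
    diagonal σ m far with ∣ m ∣ ℕ.<? K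
    ... | yes m<K = supₙ m _ (far-summand σ m far m<K)
    ... | no m≮K = supₘ m _ (ℕₚ.≮⇒≥ m≮K)
    even : ∀ s → g (s Int.+ s) ≈ Z L (λ t → f (t Int.+ s) (s Int.- t))
    even s = trans shift (Z-cong L (λ t → reflexive (≡.cong (f (t Int.+ s)) (even-reindex s t))))
      where
      shift : g (s Int.+ s) ≈ Z L (λ t → f (t Int.+ s) (s Int.+ s Int.- (t Int.+ s)))
      shift with ∣ s ∣ ℕ.≤? K
      ... | yes s≤K = sym (Z-shift s (λ m → supₘ m _) (room s s≤K))
      ... | no s≰K = trans (Z-zero L (λ m → diagonal (s Int.+ s) m far)) (sym (Z-zero L (λ t → diagonal (s Int.+ s) (t Int.+ s) far)))
        where far : K ℕ.+ K ≤ ∣ s Int.+ s ∣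
              far = far-even s (ℕₚ.<⇒≤ (ℕₚ.≰⇒> s≰K))
    odd : ∀ s → g (Int.suc (s Int.+ s)) ≈ Z L (λ t → f (t Int.+ Int.suc s) (s Int.- t))
    odd s = trans shift (Z-cong L (λ t → reflexive (≡.cong (f (t Int.+ Int.suc s)) (odd-reindex s t))))
      where
      shift : g (Int.suc (s Int.+ s)) ≈ Z L (λ t → f (t Int.+ Int.suc s) (Int.suc (s Int.+ s) Int.- (t Int.+ Int.suc s)))
      shift with ∣ Int.suc s ∣ ℕ.≤? K
      ... | yes s≤K = sym (Z-shift (Int.suc s) (λ m → supₘ m _) (room (Int.suc s) s≤K))
      ... | no s≰K = trans (Z-zero L (λ m → diagonal (Int.suc (s Int.+ s)) m far)) (sym (Z-zero L (λ t → diagonal (Int.suc (s Int.+ s)) (t Int.+ Int.suc s) far)))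
        where far : K ℕ.+ K ≤ ∣ Int.suc (s Int.+ s) ∣
              far = far-odd s (ℕₚ.≰⇒> s≰K)

  -- The absolute value only makes the power total: `pw` is multiplicative on nonnegative exponents,
  -- and `quad-nonneg` keeps all exponents there.
  pw : ℤ → Carrier
  pw i = q ^ ∣ i ∣

  pw-+ : ∀ {i j} → + 0 Int.≤ i → + 0 Int.≤ j → pw i * pw j ≈ pw (i Int.+ j)
  pw-+ {+ m} {+ n} (+≤+ _) (+≤+ _) = sym (^-homo-* q m n)

  pw-≡ : ∀ {i j k l} → + 0 Int.≤ i → + 0 Int.≤ j → + 0 Int.≤ k → + 0 Int.≤ l → i Int.+ j ≡ k Int.+ l →
    pw i * pw j ≈ pw k * pw l
  pw-≡ 0≤i 0≤j 0≤k 0≤l eq = trans (pw-+ 0≤i 0≤j) (trans (reflexive (≡.cong pw eq)) (sym (pw-+ 0≤k 0≤l)))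

  -- Integer powers of an element of square 1

  module Character (u : Carrier) (u*u≈1 : u * u ≈ 1#) where

    -- As `u` is its own inverse, the absolute value gives the correct power for negative `j` too.
    sgn : ℤ → Carrier
    sgn j = u ^ ∣ j ∣

    u*u*x≈x : ∀ x → u * (u * x) ≈ x
    u*u*x≈x x = trans (sym (*-assoc u u x)) (trans (*-congʳ u*u≈1) (*-identityˡ x))

    sgn-suc : ∀ j → sgn (Int.suc j) ≈ u * sgn j
    sgn-suc (+ n) = refl
    sgn-suc -[1+ zero ] = sym (u*u*x≈x 1#)
    sgn-suc -[1+ suc n ] = sym (u*u*x≈x (u * u ^ n))

    sgn-neg-suc : ∀ a → sgn (Int.- (+ suc a)) ≈ u * sgn (Int.- (+ a))
    sgn-neg-suc a = sym (trans (*-congˡ (trans (reflexive (≡.cong sgn (≡.sym (suc-neg a)))) (sgn-suc -[1+ a ]))) (u*u*x≈x _))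

    sgn-neg : ∀ j → sgn (Int.- j) ≡ sgn j
    sgn-neg j = ≡.cong (u ^_) (ℤₚ.∣-i∣≡∣i∣ j)

    sgn-pos-+ : ∀ n j → sgn (+ n Int.+ j) ≈ sgn (+ n) * sgn j
    sgn-pos-+ zero j = trans (reflexive (≡.cong sgn (ℤₚ.+-identityˡ j))) (sym (*-identityˡ _))
    sgn-pos-+ (suc n) j = begin
      sgn (+ suc n Int.+ j)            ≡⟨ ≡.cong sgn (ℤₚ.+-assoc (+ 1) (+ n) j) ⟩
      sgn (Int.suc (+ n Int.+ j))      ≈⟨ sgn-suc (+ n Int.+ j) ⟩
      u * sgn (+ n Int.+ j)            ≈⟨ *-congˡ (sgn-pos-+ n j) ⟩
      u * (sgn (+ n) * sgn j)          ≈⟨ *-assoc _ _ _ ⟨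
      sgn (+ suc n) * sgn j ∎

    sgn-+ : ∀ i j → sgn (i Int.+ j) ≈ sgn i * sgn j
    sgn-+ (+ n) j = sgn-pos-+ n j
    sgn-+ -[1+ n ] j = begin
      sgn (-[1+ n ] Int.+ j)             ≡⟨ sgn-neg (-[1+ n ] Int.+ j) ⟨
      sgn (Int.- (-[1+ n ] Int.+ j))     ≡⟨ ≡.cong sgn (ℤₚ.neg-distrib-+ -[1+ n ] j) ⟩
      sgn (+ suc n Int.+ Int.- j)        ≈⟨ sgn-pos-+ (suc n) (Int.- j) ⟩
      sgn (+ suc n) * sgn (Int.- j)      ≡⟨ ≡.cong (sgn (+ suc n) *_) (sgn-neg j) ⟩
      sgn -[1+ n ] * sgn j ∎

    sgn-square : ∀ j → sgn j * sgn j ≈ 1#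
    sgn-square j = begin
      sgn j * sgn j              ≡⟨ ≡.cong (sgn j *_) (sgn-neg j) ⟨
      sgn j * sgn (Int.- j)      ≈⟨ sgn-+ j (Int.- j) ⟨
      sgn (j Int.- j)            ≡⟨ ≡.cong sgn (ℤₚ.+-inverseʳ j) ⟩
      1# ∎

    sgn-even : ∀ s t → sgn (t Int.+ s) * sgn (s Int.- t) ≈ 1#
    sgn-even s t = begin
      sgn (t Int.+ s) * sgn (s Int.- t)
        ≈⟨ *-cong (sgn-+ t s) (trans (sgn-+ s (Int.- t)) (*-congˡ (reflexive (sgn-neg t)))) ⟩
      (sgn t * sgn s) * (sgn s * sgn t)
        ≈⟨ solve 2 (λ s t → (t :* s) :* (s :* t) := (s :* s) :* (t :* t)) refl (sgn s) (sgn t) ⟩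
      (sgn s * sgn s) * (sgn t * sgn t)
        ≈⟨ *-cong (sgn-square s) (sgn-square t) ⟩
      1# * 1#  ≈⟨ *-identityˡ 1# ⟩
      1# ∎
      where open Solver

    sgn-odd : ∀ s t → sgn (t Int.+ Int.suc s) * sgn (s Int.- t) ≈ u
    sgn-odd s t = begin
      sgn (t Int.+ Int.suc s) * sgn (s Int.- t)
        ≡⟨ ≡.cong (λ i → sgn i * sgn (s Int.- t)) (suc-right s t) ⟩
      sgn (Int.suc (t Int.+ s)) * sgn (s Int.- t)
        ≈⟨ *-congʳ (sgn-suc (t Int.+ s)) ⟩
      u * sgn (t Int.+ s) * sgn (s Int.- t)
        ≈⟨ trans (*-assoc _ _ _) (trans (*-congˡ (sgn-even s t)) (*-identityʳ u)) ⟩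
      u ∎

  -- The Jacobi triple product to the base q²⁰

  module TripleProduct (u : Carrier) (u*u≈1 : u * u ≈ 1#) (d d′ : ℕ) (d+d′≡18 : d ℕ.+ d′ ≡ 18) where
    open Character u u*u≈1

    term : ℤ → Carrier
    term j = sgn j * pw (quad (+ suc d) j)

    term-supported : Supported N term
    term-supported j N≤j = trans (*-congˡ (q^≈0 (ℕₚ.≤-trans N≤j (quad-far d d′ d+d′≡18 j)))) (zeroʳ _)

    factor : ℕ → ℕ → Carrier
    factor c k = 1# + u * q ^ (c ℕ.+ k ℕ.* 20)

    factor-1-w : ∀ c k → 1# - - (u * q ^ (c ℕ.+ k ℕ.* 20)) ≈ factor c k
    factor-1-w c k = +-congˡ (-‿involutive _)

    private
      recurrence : ∀ j j′ c b → sgn j′ ≈ u * sgn j → + c Int.+ quad (+ suc d) j ≡ + (20 ℕ.* b) Int.+ quad (+ suc d) j′ →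
        - (u * q ^ c) * term j ≈ - (Q b * term j′)
      recurrence j j′ c b sg eq = begin
        - (u * q ^ c) * (sgn j * y)
          ≈⟨ solve 4 (λ u x s y → (:- (u :* x)) :* (s :* y) := :- ((u :* s) :* (x :* y))) refl u (q ^ c) (sgn j) y ⟩
        - ((u * sgn j) * (q ^ c * y))
          ≈⟨ -‿cong (*-cong (sym sg) (pw-≡ {+ c} {k = + (20 ℕ.* b)} (+≤+ z≤n) (nonneg j) (+≤+ z≤n) (nonneg j′) eq)) ⟩
        - (sgn j′ * (Q b * y′))
          ≈⟨ -‿cong (x∙yz≈y∙xz (sgn j′) (Q b) y′) ⟩
        - (Q b * (sgn j′ * y′)) ∎
        where
        open Solver
        nonneg = quad-nonneg d d′ d+d′≡18
        y = pw (quad (+ suc d) j)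
        y′ = pw (quad (+ suc d) j′)

    -- The q-binomial theorem for one of the two progressions, with its terms written as those of
    -- the theta sum at -a, so that `upper-half` can extend the same sum.
    lower-half : ∀ k → ∏ k (factor (suc d′)) ≈ AD (λ a b → binomial a b * term (Int.- (+ a))) 0 k
    lower-half zero = sym (trans (*-congʳ (binomial-0ˡ 0)) (trans (*-identityˡ _) (trans (*-identityˡ _)
      (reflexive (≡.cong pw (quad-zero (+ suc d)))))))
    lower-half (suc k) = trans (*-cong (lower-half k) (sym (factor-1-w (suc d′) k)))
      (sym (binomial-sum-suc (- (u * q ^ (suc d′ ℕ.+ k ℕ.* 20))) (λ a → term (Int.- (+ a))) k
        (λ a b eq → recurrence (Int.- (+ a)) (Int.- (+ suc a)) (suc d′ ℕ.+ k ℕ.* 20) b (sgn-neg-suc a) (down-exponent d d′ k a b d+d′≡18 eq))))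

    -- Each factor of the other progression lengthens the sum by one while the centre `M` stays
    -- fixed.
    upper-half : ∀ M k → AD (λ a b → binomial a b * term (+ a Int.- + M)) 0 (M ℕ.+ k) ≈
      AD (λ a b → binomial a b * term (+ a Int.- + M)) 0 M * ∏ k (factor (suc d))
    upper-half M zero = trans (reflexive (≡.cong (AD _ 0) (ℕₚ.+-identityʳ M))) (sym (*-identityʳ _))
    upper-half M (suc k) = begin
      AD g 0 (M ℕ.+ suc k)
        ≡⟨ ≡.cong (AD g 0) (ℕₚ.+-suc M k) ⟩
      AD g 0 (suc (M ℕ.+ k))
        ≈⟨ binomial-sum-suc (- (u * q ^ (suc d ℕ.+ k ℕ.* 20))) τ (M ℕ.+ k)
             (λ a b eq → trans (recurrence (+ a Int.- + M) (Int.suc (+ a Int.- + M)) (suc d ℕ.+ k ℕ.* 20) b (sgn-suc (+ a Int.- + M)) (up-exponent d M k a b eq))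
               (-‿cong (*-congˡ (reflexive (≡.cong term (≡.sym (ℤₚ.+-assoc (+ 1) (+ a) (Int.- + M)))))))) ⟩
      AD g 0 (M ℕ.+ k) * (1# - - (u * q ^ (suc d ℕ.+ k ℕ.* 20)))
        ≈⟨ *-cong (upper-half M k) (factor-1-w (suc d) k) ⟩
      AD g 0 M * ∏ k (factor (suc d)) * factor (suc d) k
        ≈⟨ *-assoc _ _ _ ⟩
      AD g 0 M * ∏ (suc k) (factor (suc d)) ∎
      where
      τ = λ a → term (+ a Int.- + M)
      g = λ a b → binomial a b * τ a

    -- On the antidiagonal a + b = L one has a - L = -b, so the sum with which `upper-half` starts
    -- at M = L is `lower-half` read backwards.
    finite-triple-product : ∀ L → ∏ L (factor (suc d′)) * ∏ L (factor (suc d)) ≈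
      AD (λ a b → binomial a b * term (+ a Int.- + L)) 0 (L ℕ.+ L)
    finite-triple-product L = sym (trans (upper-half L L) (*-congʳ (begin
      AD (λ a b → binomial a b * term (+ a Int.- + L)) 0 L
        ≈⟨ AD-cong 0 L (λ a b eq → *-cong (binomial-sym a b) (reflexive (≡.cong term (sub-antidiagonal a b L eq)))) ⟩
      AD (λ a b → binomial b a * term (Int.- (+ b))) 0 L
        ≈⟨ AD-flip (λ a b → binomial b a * term (Int.- (+ b))) L ⟩
      AD (λ a b → binomial a b * term (Int.- (+ a))) 0 L
        ≈⟨ lower-half L ⟨
      ∏ L (factor (suc d′)) ∎)))

    triple-product : ∀ L → N ℕ.+ N ≤ L → E∞ * (∏ L (factor (suc d′)) * ∏ L (factor (suc d))) ≈ Z L term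
    triple-product L 2N≤L = begin
      E∞ * (∏ L (factor (suc d′)) * ∏ L (factor (suc d)))
        ≈⟨ *-congˡ (finite-triple-product L) ⟩
      E∞ * AD (λ a b → binomial a b * τ a) 0 (L ℕ.+ L)
        ≈⟨ AD-scale E∞ (λ a b → binomial a b * τ a) 0 (L ℕ.+ L) ⟩
      AD (λ a b → E∞ * (binomial a b * τ a)) 0 (L ℕ.+ L)
        ≈⟨ AD-cong 0 (L ℕ.+ L) limit ⟩
      AD (λ a b → τ a) 0 (L ℕ.+ L)
        ≈⟨ AD-Z L term ⟩
      Z L term ∎
      where
      τ = λ a → term (+ a Int.- + L)
      vanishing : ∀ a b → N ≤ ∣ + a Int.- + L ∣ → E∞ * (binomial a b * τ a) ≈ τ a
      vanishing a b far = trans (*-congˡ (trans (*-congˡ τ≈0) (zeroʳ _))) (trans (zeroʳ _) (sym τ≈0))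
        where τ≈0 = term-supported (+ a Int.- + L) far
      -- If one index is at most `N`, then |a - L| ≥ N because L ≥ 2N, and the theta term is zero.
      -- Otherwise both are at least `N`, and the binomial has reached its limit 1 / E∞.
      limit : ∀ a b → a ℕ.+ b ≡ L ℕ.+ L → E∞ * (binomial a b * τ a) ≈ τ a
      limit a b eq with ℕₚ.≤-total a N | ℕₚ.≤-total b N
      ... | inj₁ a≤N | _ = vanishing a b (far-left a a≤N 2N≤L)
      ... | inj₂ _ | inj₁ b≤N = vanishing a b (far-right a b eq b≤N 2N≤L)
      ... | inj₂ N≤a | inj₂ N≤b = trans (sym (*-assoc _ _ _)) (trans (*-congʳ (binomial-limit N≤a N≤b)) (*-identityˡ _))

  -- Theta products as 2 × 2 determinants, and Weierstrass' relation

  module Determinant (L : ℕ) (3N≤L : N ℕ.+ (N ℕ.+ N) ≤ L) where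

    2N≤L : N ℕ.+ N ≤ L
    2N≤L = ℕₚ.≤-trans (ℕₚ.m≤n+m (N ℕ.+ N) N) 3N≤L

    -- The theta function of z = -u q^(d+1) to the base q²⁰, truncated.
    θ : Carrier → ℕ → Carrier
    θ u d = progression u (18 ℕ.∸ d) 20 L * progression u d 20 L

    doubled : ℕ → ℤ → ℤ
    doubled a s = quad (+ suc a) s Int.+ quad (+ suc a) s

    -- For the point x = ± q^(a+1) this is the sum of x^(2s) q^(20s(s-1)); only even powers of x
    -- occur, so its sign drops out.
    ξ : ℕ → Carrier
    ξ a = Z L (λ s → pw (doubled a s))

    -- For x = q^(a+1) this is the sum of x^(2s+1) q^(20s²). For a point of sign ε the odd powers
    -- leave one factor ε, which is written outside.
    η : ℕ → Carrier
    η a = Z L (λ s → pw (doubled (10 ℕ.+ a) s Int.+ + suc a))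

    doubled-nonneg : ∀ {a} → a ≤ 18 → ∀ s → + 0 Int.≤ doubled a s
    doubled-nonneg {a} a≤18 s = double-nonneg (quad-nonneg a (18 ℕ.∸ a) (ℕₚ.m+[n∸m]≡n a≤18) s)

    ξ-supported : ∀ {a} → a ≤ 18 → Supported N (λ s → pw (doubled a s))
    ξ-supported {a} a≤18 s N≤s = q^≈0 (≡.subst (N ≤_) (≡.sym (∣i+i∣ (quad (+ suc a) s)))
      (ℕₚ.≤-trans N≤s (ℕₚ.≤-trans (quad-far a (18 ℕ.∸ a) (ℕₚ.m+[n∸m]≡n a≤18) s) (ℕₚ.m≤m+n _ _))))

    -- The factor ε₂ q^(b+1) is the second point, the monomial that `even-exponent` and
    -- `odd-exponent` ask for. Pairs with m + n even give the first product. Those with m + n odd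
    -- carry in addition u = -ε₁ε₂, and ε₂u = -ε₁ is the minus sign of the determinant. The bound a
    -- ≤ 8 keeps the indices 10 + a of `η` and a + b + 1 of `θ` at most 18.
    θ-determinant : ∀ ε₁ ε₂ a b → ε₁ * ε₁ ≈ 1# → ε₂ * ε₂ ≈ 1# → a ≤ 8 → b < a →
      ε₂ * q ^ suc b * ((E∞ * θ (- (ε₁ * ε₂)) (suc a ℕ.+ b)) * (E∞ * θ (- (ε₁ * ε₂)) (a ℕ.∸ suc b))) ≈
        ξ a * (ε₂ * η b) - ε₁ * η a * ξ b
    θ-determinant ε₁ ε₂ a b ε₁² ε₂² a≤8 b<a = begin
      y * ((E∞ * θ u d₁) * (E∞ * θ u d₂))
        ≈⟨ *-congˡ (*-cong (T₁.triple-product L 2N≤L) (T₂.triple-product L 2N≤L)) ⟩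
      y * (Z L T₁.term * Z L T₂.term)
        ≈⟨ *-congˡ (trans (Z-cong L (λ m → Z-scaleˡ L (T₁.term m) T₂.term)) (Z-scaleʳ L (Z L T₂.term) T₁.term)) ⟨
      y * Z L (λ m → Z L (λ n → T₁.term m * T₂.term n))
        ≈⟨ trans (Z-cong L (λ m → Z-scaleˡ L y _)) (Z-scaleˡ L y _) ⟨
      Z L (λ m → Z L (f m))
        ≈⟨ Z-rotate N L f
             (λ m n far → trans (*-congˡ (trans (*-congʳ (T₁.term-supported m far)) (zeroˡ _))) (zeroʳ y))
             (λ m n far → trans (*-congˡ (trans (*-congˡ (T₂.term-supported n far)) (zeroʳ _))) (zeroʳ y)) 3N≤L ⟩
      Z L (λ s → Z L (λ t → f (t Int.+ s) (s Int.- t))) + Z L (λ s → Z L (λ t → f (t Int.+ Int.suc s) (s Int.- t)))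
        ≈⟨ +-cong (Z-cong L (λ s → Z-cong L (even s))) (Z-cong L (λ s → Z-cong L (odd s))) ⟩
      Z L (λ s → Z L (λ t → pw (doubled a s) * (ε₂ * pw (doubled (10 ℕ.+ b) t Int.+ + suc b)))) +
      Z L (λ s → Z L (λ t → (- ε₁ * pw (doubled (10 ℕ.+ a) s Int.+ + suc a)) * pw (doubled b (Int.suc t))))
        ≈⟨ +-cong (trans (Z-cong L (λ s → Z-scaleˡ L _ _)) (Z-scaleʳ L _ _))
                  (trans (Z-cong L (λ s → Z-scaleˡ L _ _)) (Z-scaleʳ L _ _)) ⟩
      ξ a * Z L (λ t → ε₂ * pw (doubled (10 ℕ.+ b) t Int.+ + suc b)) +
      Z L (λ s → - ε₁ * pw (doubled (10 ℕ.+ a) s Int.+ + suc a)) * Z L (λ t → pw (doubled b (Int.suc t)))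
        ≈⟨ +-cong (*-congˡ (Z-scaleˡ L ε₂ _)) (*-cong (Z-scaleˡ L (- ε₁) _) (Z-suc-supported (ξ-supported b≤18) N≤L)) ⟩
      ξ a * (ε₂ * η b) + - ε₁ * η a * ξ b
        ≈⟨ +-congˡ (solve 3 (λ e h x → :- e :* h :* x := :- (e :* h :* x)) refl ε₁ (η a) (ξ b)) ⟩
      ξ a * (ε₂ * η b) - ε₁ * η a * ξ b ∎
      where
      open Solver
      u = - (ε₁ * ε₂)
      d₁ = suc a ℕ.+ b
      d₂ = a ℕ.∸ suc b
      y = ε₂ * q ^ suc b
      N≤L : N ≤ L
      N≤L = ℕₚ.≤-trans (ℕₚ.m≤m+n N N) 2N≤L
      u*u≈1 : u * u ≈ 1#
      u*u≈1 = trans (solve 2 (λ x y → :- (x :* y) :* :- (x :* y) := (x :* x) :* (y :* y)) refl ε₁ ε₂)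
        (trans (*-cong ε₁² ε₂²) (*-identityˡ 1#))
      8≤18 : 8 ≤ 18
      8≤18 = ℕₚ.m≤m+n 8 10
      b≤8 : b ≤ 8
      b≤8 = ℕₚ.≤-trans (ℕₚ.<⇒≤ b<a) a≤8
      a≤18 : a ≤ 18
      a≤18 = ℕₚ.≤-trans a≤8 8≤18
      b≤18 : b ≤ 18
      b≤18 = ℕₚ.≤-trans b≤8 8≤18
      d₁≤18 : d₁ ≤ 18
      d₁≤18 = ℕₚ.≤-trans (ℕₚ.+-mono-≤ (s≤s a≤8) b≤8) (ℕₚ.m≤m+n 17 1)
      d₂≤18 : d₂ ≤ 18
      d₂≤18 = ℕₚ.≤-trans (ℕₚ.m∸n≤m a (suc b)) a≤18
      module T₁ = TripleProduct u u*u≈1 d₁ (18 ℕ.∸ d₁) (ℕₚ.m+[n∸m]≡n d₁≤18)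
      module T₂ = TripleProduct u u*u≈1 d₂ (18 ℕ.∸ d₂) (ℕₚ.m+[n∸m]≡n d₂≤18)
      open Character u u*u≈1
      f : ℤ → ℤ → Carrier
      f m n = y * (T₁.term m * T₂.term n)
      sum-index : + suc d₁ ≡ + suc a Int.+ + suc b
      sum-index = ≡.cong (λ n → + suc n) (≡.sym (ℕₚ.+-suc a b))
      diff-index : + suc d₂ ≡ + suc a Int.- + suc b
      diff-index = ≡.trans (≡.trans (≡.cong +_ (≡.sym (ℕₚ.+-∸-assoc 1 b<a))) (≡.sym (ℤₚ.⊖-≥ (ℕₚ.m≤n⇒m≤1+n b<a)))) (≡.sym (ℤₚ.m-n≡m⊖n (suc a) (suc b)))
      nonneg₁ = quad-nonneg d₁ (18 ℕ.∸ d₁) (ℕₚ.m+[n∸m]≡n d₁≤18)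
      nonneg₂ = quad-nonneg d₂ (18 ℕ.∸ d₂) (ℕₚ.m+[n∸m]≡n d₂≤18)
      collect : ∀ m n → f m n ≈ (ε₂ * (sgn m * sgn n)) * pw (+ suc b Int.+ (quad (+ suc d₁) m Int.+ quad (+ suc d₂) n))
      collect m n = begin
        ε₂ * q ^ suc b * ((sgn m * p₁) * (sgn n * p₂))
          ≈⟨ solve 6 (λ e x s p r t → e :* x :* ((s :* p) :* (r :* t)) := (e :* (s :* r)) :* (x :* (p :* t))) refl ε₂ (q ^ suc b) (sgn m) p₁ (sgn n) p₂ ⟩
        (ε₂ * (sgn m * sgn n)) * (q ^ suc b * (p₁ * p₂))
          ≈⟨ *-congˡ (trans (*-congˡ (pw-+ (nonneg₁ m) (nonneg₂ n))) (pw-+ {+ suc b} (+≤+ z≤n) (ℤₚ.+-mono-≤ (nonneg₁ m) (nonneg₂ n)))) ⟩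
        (ε₂ * (sgn m * sgn n)) * pw (+ suc b Int.+ (quad (+ suc d₁) m Int.+ quad (+ suc d₂) n)) ∎
        where
        p₁ = pw (quad (+ suc d₁) m)
        p₂ = pw (quad (+ suc d₂) n)
      even : ∀ s t → f (t Int.+ s) (s Int.- t) ≈ pw (doubled a s) * (ε₂ * pw (doubled (10 ℕ.+ b) t Int.+ + suc b))
      even s t = begin
        f (t Int.+ s) (s Int.- t)
          ≈⟨ collect (t Int.+ s) (s Int.- t) ⟩
        (ε₂ * (sgn (t Int.+ s) * sgn (s Int.- t))) * pw (+ suc b Int.+ (quad (+ suc d₁) (t Int.+ s) Int.+ quad (+ suc d₂) (s Int.- t)))
          ≈⟨ *-cong (trans (*-congˡ (sgn-even s t)) (*-identityʳ ε₂)) (reflexive (≡.cong pw (even-exponent (+ suc a) (+ suc b) sum-index diff-index s t))) ⟩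
        ε₂ * pw (doubled a s Int.+ (doubled (10 ℕ.+ b) t Int.+ + suc b))
          ≈⟨ *-congˡ (pw-+ (doubled-nonneg a≤18 s) (ℤₚ.+-mono-≤ (doubled-nonneg (ℕₚ.+-monoʳ-≤ 10 b≤8) t) (+≤+ z≤n))) ⟨
        ε₂ * (pw (doubled a s) * pw (doubled (10 ℕ.+ b) t Int.+ + suc b))
          ≈⟨ x∙yz≈y∙xz _ _ _ ⟩
        pw (doubled a s) * (ε₂ * pw (doubled (10 ℕ.+ b) t Int.+ + suc b)) ∎
      odd : ∀ s t → f (t Int.+ Int.suc s) (s Int.- t) ≈ (- ε₁ * pw (doubled (10 ℕ.+ a) s Int.+ + suc a)) * pw (doubled b (Int.suc t))
      odd s t = begin
        f (t Int.+ Int.suc s) (s Int.- t)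
          ≈⟨ collect (t Int.+ Int.suc s) (s Int.- t) ⟩
        (ε₂ * (sgn (t Int.+ Int.suc s) * sgn (s Int.- t))) * pw (+ suc b Int.+ (quad (+ suc d₁) (t Int.+ Int.suc s) Int.+ quad (+ suc d₂) (s Int.- t)))
          ≈⟨ *-cong (trans (*-congˡ (sgn-odd s t)) ε₂u) (reflexive (≡.cong pw (odd-exponent (+ suc a) (+ suc b) sum-index diff-index s t))) ⟩
        - ε₁ * pw (doubled (10 ℕ.+ a) s Int.+ + suc a Int.+ doubled b (Int.suc t))
          ≈⟨ *-congˡ (pw-+ (ℤₚ.+-mono-≤ (doubled-nonneg (ℕₚ.+-monoʳ-≤ 10 a≤8) s) (+≤+ z≤n)) (doubled-nonneg b≤18 (Int.suc t))) ⟨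
        - ε₁ * (pw (doubled (10 ℕ.+ a) s Int.+ + suc a) * pw (doubled b (Int.suc t)))
          ≈⟨ *-assoc _ _ _ ⟨
        (- ε₁ * pw (doubled (10 ℕ.+ a) s Int.+ + suc a)) * pw (doubled b (Int.suc t)) ∎
        where
        ε₂u : ε₂ * u ≈ - ε₁
        ε₂u = trans (solve 2 (λ x y → y :* :- (x :* y) := :- (x :* (y :* y))) refl ε₁ ε₂) (-‿cong (trans (*-congˡ ε₂²) (*-identityʳ ε₁)))

    ⟦_⟧ₛ : Sign → Carrier
    ⟦ Sgn.+ ⟧ₛ = 1#
    ⟦ Sgn.- ⟧ₛ = - 1#

    ⟦⟧ₛ-square : ∀ s → ⟦ s ⟧ₛ * ⟦ s ⟧ₛ ≈ 1#
    ⟦⟧ₛ-square Sgn.+ = *-identityˡ 1#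
    ⟦⟧ₛ-square Sgn.- = solve 0 (:- :1 :* :- :1 := :1) refl
      where open Solver

    ⟦⟧ₛ-opposite : ∀ s t → - (⟦ s ⟧ₛ * ⟦ t ⟧ₛ) ≈ ⟦ Sgn.opposite (s Sgn.* t) ⟧ₛ
    ⟦⟧ₛ-opposite Sgn.+ Sgn.+ = -‿cong (*-identityˡ 1#)
    ⟦⟧ₛ-opposite Sgn.+ Sgn.- = trans (-‿cong (*-identityˡ (- 1#))) (-‿involutive 1#)
    ⟦⟧ₛ-opposite Sgn.- Sgn.+ = trans (-‿cong (*-identityʳ (- 1#))) (-‿involutive 1#)
    ⟦⟧ₛ-opposite Sgn.- Sgn.- = -‿cong (⟦⟧ₛ-square Sgn.-)

    -- The pair (s , a) stands for s q^(a+1).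
    Point : Set
    Point = Sign × ℕ

    -- This is Tᵢⱼ: the product of the points has exponent a + b + 2 and the quotient a - b. The
    -- sign is reversed because the factors of `progression` are 1 + u q^n, while those of [z]
    -- contain 1 - z.
    Θ : Point → Point → Carrier
    Θ (s , a) (t , b) = θ ⟦ Sgn.opposite (s Sgn.* t) ⟧ₛ (suc a ℕ.+ b) * θ ⟦ Sgn.opposite (s Sgn.* t) ⟧ₛ (a ℕ.∸ suc b)

    Θ-determinant : ∀ s a t b → a ≤ 8 → b < a →
      (E∞ * E∞) * (⟦ t ⟧ₛ * (q ^ suc b * Θ (s , a) (t , b))) ≈ ξ a * (⟦ t ⟧ₛ * η b) - ⟦ s ⟧ₛ * η a * ξ b
    Θ-determinant s a t b a≤8 b<a = trans
      (trans (solve 5 (λ E t x y z → (E :* E) :* (t :* (x :* (y :* z))) := t :* x :* ((E :* y) :* (E :* z))) refl E∞ ⟦ t ⟧ₛ (q ^ suc b) _ _)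
        (*-congˡ (*-cong (*-congˡ (θ-cong (suc a ℕ.+ b))) (*-congˡ (θ-cong (a ℕ.∸ suc b))))))
      (θ-determinant ⟦ s ⟧ₛ ⟦ t ⟧ₛ a b (⟦⟧ₛ-square s) (⟦⟧ₛ-square t) a≤8 b<a)
      where
      open Solver
      θ-cong : ∀ d → θ ⟦ Sgn.opposite (s Sgn.* t) ⟧ₛ d ≈ θ (- (⟦ s ⟧ₛ * ⟦ t ⟧ₛ)) d
      θ-cong d = *-cong (progression-cong (18 ℕ.∸ d) 20 L (sym (⟦⟧ₛ-opposite s t))) (progression-cong d 20 L (sym (⟦⟧ₛ-opposite s t)))

    -- Plücker's identity for the four columns (ξᵢ , eᵢ ηᵢ). By `Θ-determinant` each Tᵢⱼ comes
    -- multiplied by xⱼ: the products T₁₃T₂₄ and T₁₄T₂₃ by x₃x₄, but T₁₂T₃₄ by x₂x₄. The quotient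
    -- x₂/x₃ is the origin of the signs and of `q ^ δ`. The signs and powers of `E∞` are units and
    -- cancel; the common power of `q` does not.
    weierstrass : ∀ s₁ a₁ s₂ a₂ s₃ a₃ s₄ a₄ δ → a₁ ≤ 8 → a₂ < a₁ → a₃ < a₂ → a₄ < a₃ → a₂ ≡ δ ℕ.+ a₃ →
      q ^ (suc a₃ ℕ.+ suc a₄) * (⟦ s₂ ⟧ₛ * ⟦ s₃ ⟧ₛ * q ^ δ * (Θ (s₁ , a₁) (s₂ , a₂) * Θ (s₃ , a₃) (s₄ , a₄)) +
        Θ (s₁ , a₁) (s₄ , a₄) * Θ (s₂ , a₂) (s₃ , a₃)) ≈
      q ^ (suc a₃ ℕ.+ suc a₄) * (Θ (s₁ , a₁) (s₃ , a₃) * Θ (s₂ , a₂) (s₄ , a₄))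
    weierstrass s₁ a₁ s₂ a₂ s₃ a₃ s₄ a₄ δ a₁≤8 a₂<a₁ a₃<a₂ a₄<a₃ a₂≡δ+a₃ = unit-cancel unit (begin
      w * (q ^ (suc a₃ ℕ.+ suc a₄) * (e₂ * e₃ * q ^ δ * (T₁₂ * T₃₄) + T₁₄ * T₂₃))
        ≈⟨ *-congˡ (*-congʳ (^-homo-* q (suc a₃) (suc a₄))) ⟩
      w * ((x₃ * x₄) * (e₂ * e₃ * q ^ δ * (T₁₂ * T₃₄) + T₁₄ * T₂₃))
        ≈⟨ solve 11 (λ e₂ e₃ e₄ E x₃ x₄ d T₁₂ T₃₄ T₁₄ T₂₃ →
             (e₃ :* e₄ :* ((E :* E) :* (E :* E))) :* ((x₃ :* x₄) :* (e₂ :* e₃ :* d :* (T₁₂ :* T₃₄) :+ T₁₄ :* T₂₃))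
               := (e₃ :* e₃) :* (((E :* E) :* (e₂ :* ((d :* x₃) :* T₁₂))) :* ((E :* E) :* (e₄ :* (x₄ :* T₃₄))))
                  :+ ((E :* E) :* (e₄ :* (x₄ :* T₁₄))) :* ((E :* E) :* (e₃ :* (x₃ :* T₂₃)))) refl
             e₂ e₃ e₄ E∞ x₃ x₄ (q ^ δ) T₁₂ T₃₄ T₁₄ T₂₃ ⟩
      (e₃ * e₃) * (((E∞ * E∞) * (e₂ * ((q ^ δ * x₃) * T₁₂))) * ((E∞ * E∞) * (e₄ * (x₄ * T₃₄)))) +
        ((E∞ * E∞) * (e₄ * (x₄ * T₁₄))) * ((E∞ * E∞) * (e₃ * (x₃ * T₂₃)))
        ≈⟨ +-cong (trans (*-cong (⟦⟧ₛ-square s₃)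
                    (*-cong (trans (*-congˡ (*-congˡ (*-congʳ shift))) (Θ-determinant s₁ a₁ s₂ a₂ a₁≤8 a₂<a₁))
                            (Θ-determinant s₃ a₃ s₄ a₄ a₃≤8 a₄<a₃))) (*-identityˡ _))
                  (*-cong (Θ-determinant s₁ a₁ s₄ a₄ a₁≤8 (ℕₚ.<-trans a₄<a₃ a₃<a₁)) (Θ-determinant s₂ a₂ s₃ a₃ a₂≤8 a₃<a₂)) ⟩
      (ξ a₁ * (e₂ * η a₂) - e₁ * η a₁ * ξ a₂) * (ξ a₃ * (e₄ * η a₄) - e₃ * η a₃ * ξ a₄) +
        (ξ a₁ * (e₄ * η a₄) - e₁ * η a₁ * ξ a₄) * (ξ a₂ * (e₃ * η a₃) - e₂ * η a₂ * ξ a₃)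
        ≈⟨ solve 8 (λ x₁ x₂ x₃ x₄ y₁ y₂ y₃ y₄ →
             (x₁ :* y₂ :- y₁ :* x₂) :* (x₃ :* y₄ :- y₃ :* x₄) :+ (x₁ :* y₄ :- y₁ :* x₄) :* (x₂ :* y₃ :- y₂ :* x₃)
               := (x₁ :* y₃ :- y₁ :* x₃) :* (x₂ :* y₄ :- y₂ :* x₄)) refl
             (ξ a₁) (ξ a₂) (ξ a₃) (ξ a₄) (e₁ * η a₁) (e₂ * η a₂) (e₃ * η a₃) (e₄ * η a₄) ⟩
      (ξ a₁ * (e₃ * η a₃) - e₁ * η a₁ * ξ a₃) * (ξ a₂ * (e₄ * η a₄) - e₂ * η a₂ * ξ a₄)
        ≈⟨ *-cong (Θ-determinant s₁ a₁ s₃ a₃ a₁≤8 a₃<a₁) (Θ-determinant s₂ a₂ s₄ a₄ a₂≤8 (ℕₚ.<-trans a₄<a₃ a₃<a₂)) ⟨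
      ((E∞ * E∞) * (e₃ * (x₃ * T₁₃))) * ((E∞ * E∞) * (e₄ * (x₄ * T₂₄)))
        ≈⟨ solve 7 (λ e₃ e₄ E x₃ x₄ T₁₃ T₂₄ →
             ((E :* E) :* (e₃ :* (x₃ :* T₁₃))) :* ((E :* E) :* (e₄ :* (x₄ :* T₂₄)))
               := (e₃ :* e₄ :* ((E :* E) :* (E :* E))) :* ((x₃ :* x₄) :* (T₁₃ :* T₂₄))) refl
             e₃ e₄ E∞ x₃ x₄ T₁₃ T₂₄ ⟩
      w * ((x₃ * x₄) * (T₁₃ * T₂₄))
        ≈⟨ *-congˡ (*-congʳ (^-homo-* q (suc a₃) (suc a₄))) ⟨
      w * (q ^ (suc a₃ ℕ.+ suc a₄) * (T₁₃ * T₂₄)) ∎)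
      where
      open Solver
      e₁ = ⟦ s₁ ⟧ₛ
      e₂ = ⟦ s₂ ⟧ₛ
      e₃ = ⟦ s₃ ⟧ₛ
      e₄ = ⟦ s₄ ⟧ₛ
      x₃ = q ^ suc a₃
      x₄ = q ^ suc a₄
      T₁₂ = Θ (s₁ , a₁) (s₂ , a₂)
      T₃₄ = Θ (s₃ , a₃) (s₄ , a₄)
      T₁₄ = Θ (s₁ , a₁) (s₄ , a₄)
      T₂₃ = Θ (s₂ , a₂) (s₃ , a₃)
      T₁₃ = Θ (s₁ , a₁) (s₃ , a₃)
      T₂₄ = Θ (s₂ , a₂) (s₄ , a₄)
      w = e₃ * e₄ * ((E∞ * E∞) * (E∞ * E∞))
      unit : Unit w
      unit = unit-* (unit-* (e₃ , ⟦⟧ₛ-square s₃) (e₄ , ⟦⟧ₛ-square s₄)) (unit-* (unit-* E∞-unit E∞-unit) (unit-* E∞-unit E∞-unit))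
      a₃<a₁ = ℕₚ.<-trans a₃<a₂ a₂<a₁
      a₂≤8 = ℕₚ.≤-trans (ℕₚ.<⇒≤ a₂<a₁) a₁≤8
      a₃≤8 = ℕₚ.≤-trans (ℕₚ.<⇒≤ a₃<a₂) a₂≤8
      shift : q ^ δ * x₃ ≈ q ^ suc a₂
      shift = trans (sym (^-homo-* q δ (suc a₃))) (reflexive (≡.cong (q ^_) (≡.trans (ℕₚ.+-suc δ a₃) (≡.cong suc (≡.sym a₂≡δ+a₃)))))

    -- Theta products as fractions in residue classes modulo 40

    F : ℕ → Carrier
    F i = progression (- 1#) i 40 N

    F-unit : ∀ i → Unit (F i)
    F-unit i = ∏-unit N (λ k → Product.map₂ (trans (*-congˡ (+-congˡ (solve 1 (λ x → :- :1 :* x := :- x) refl _)))) (unit-1-q^ (i ℕ.+ k ℕ.* 40)))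
      where open Solver

    N≤2N : N ≤ N ℕ.+ N
    N≤2N = ℕₚ.m≤m+n N N

    -- Splitting base 20 into base 40 needs an even number of factors, so the length passes through
    -- 2N; from `N` on all lengths give the same product.
    progression-20 : ∀ u i → progression u i 20 L ≈ progression u i 40 N * progression u (i ℕ.+ 20) 40 N
    progression-20 u i = begin
      progression u i 20 L               ≈⟨ progression-stable u i 19 (ℕₚ.≤-trans N≤2N 2N≤L) ⟩
      progression u i 20 N               ≈⟨ progression-stable u i 19 N≤2N ⟨
      progression u i 20 (N ℕ.+ N)       ≈⟨ progression-split u i 20 N ⟩
      progression u i 40 N * progression u (i ℕ.+ 20) 40 N ∎

    progression-20-square : ∀ i → progression 1# i 20 L * (F i * F (i ℕ.+ 20)) ≈ F (suc (i ℕ.+ i))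
    progression-20-square i = begin
      progression 1# i 20 L * (F i * F (i ℕ.+ 20))          ≈⟨ *-congˡ (progression-20 (- 1#) i) ⟨
      progression 1# i 20 L * progression (- 1#) i 20 L     ≈⟨ progression-square i 20 L ⟩
      progression (- 1#) (suc (i ℕ.+ i)) 40 L               ≈⟨ progression-stable (- 1#) (suc (i ℕ.+ i)) 39 (ℕₚ.≤-trans N≤2N 2N≤L) ⟩
      F (suc (i ℕ.+ i)) ∎

    Φ : List ℕ → Carrier
    Φ [] = 1#
    Φ (i ∷ is) = F i * Φ is

    Φ-++ : ∀ is js → Φ (is ++ js) ≈ Φ is * Φ js
    Φ-++ [] js = sym (*-identityˡ _)
    Φ-++ (i ∷ is) js = trans (*-congˡ (Φ-++ is js)) (sym (*-assoc _ _ _))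

    Φ-unit : ∀ is → Unit (Φ is)
    Φ-unit [] = 1# , *-identityˡ 1#
    Φ-unit (i ∷ is) = unit-* (F-unit i) (Φ-unit is)

    Φ-↭ : ∀ {is js} → is ↭ js → Φ is ≈ Φ js
    Φ-↭ Perm.refl = refl
    Φ-↭ (Perm.prep i p) = *-congˡ (Φ-↭ p)
    Φ-↭ (Perm.swap i j p) = trans (x∙yz≈y∙xz _ _ _) (*-congˡ (*-congˡ (Φ-↭ p)))
    Φ-↭ (Perm.trans p r) = trans (Φ-↭ p) (Φ-↭ r)

    Φ-sort : ∀ {is js} → sort is ≡ sort js → Φ is ≈ Φ js
    Φ-sort {is} {js} eq = trans (sym (Φ-↭ (sort-↭ is))) (trans (reflexive (≡.cong Φ eq)) (Φ-↭ (sort-↭ js)))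

    Fraction : Set
    Fraction = List ℕ × List ℕ

    infixl 7 _⊗_
    _⊗_ : Fraction → Fraction → Fraction
    (m , n) ⊗ (m′ , n′) = m ++ m′ , n ++ n′

    infix 4 _≋_
    -- The value of the fraction of `Φ`-products, stated by cross multiplication.
    record _≋_ (x : Carrier) (f : Fraction) : Set where
      constructor mk≋
      field cross : x * Φ (proj₂ f) ≈ Φ (proj₁ f)
    open _≋_

    ≋-* : ∀ {x y f g} → x ≋ f → y ≋ g → x * y ≋ f ⊗ g
    ≋-* {x} {y} {m , n} {m′ , n′} p r = mk≋ (begin
      (x * y) * Φ (n ++ n′)          ≈⟨ *-congˡ (Φ-++ n n′) ⟩
      (x * y) * (Φ n * Φ n′)         ≈⟨ interchange x y (Φ n) (Φ n′) ⟩
      (x * Φ n) * (y * Φ n′)         ≈⟨ *-cong (cross p) (cross r) ⟩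
      Φ m * Φ m′                     ≈⟨ Φ-++ m m′ ⟨
      Φ (m ++ m′) ∎)

    infix 4 _≐_
    -- Equality of fractions after cross multiplication, as multisets. For closed lists sorting
    -- makes it decidable by evaluation, so each instance used below is `refl`.
    _≐_ : Fraction → Fraction → Set
    (m , n) ≐ (m′ , n′) = sort (m ++ n′) ≡ sort (m′ ++ n)

    ≋-unique : ∀ {x y f g} → f ≐ g → x ≋ f → y ≋ g → x ≈ y
    ≋-unique {x} {y} {m , n} {m′ , n′} eq p r = unit-cancel (unit-* (Φ-unit n) (Φ-unit n′)) (begin
      Φ n * Φ n′ * x       ≈⟨ solve 3 (λ a b x → a :* b :* x := x :* a :* b) refl (Φ n) (Φ n′) x ⟩
      x * Φ n * Φ n′       ≈⟨ *-congʳ (cross p) ⟩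
      Φ m * Φ n′           ≈⟨ Φ-++ m n′ ⟨
      Φ (m ++ n′)          ≈⟨ Φ-sort {m ++ n′} {m′ ++ n} eq ⟩
      Φ (m′ ++ n)          ≈⟨ Φ-++ m′ n ⟩
      Φ m′ * Φ n           ≈⟨ *-congʳ (cross r) ⟨
      y * Φ n′ * Φ n       ≈⟨ solve 3 (λ a b x → x :* b :* a := a :* b :* x) refl (Φ n) (Φ n′) y ⟩
      Φ n * Φ n′ * y ∎)
      where open Solver

    inverse : ∀ f → ∃ λ x → x ≋ f
    inverse (m , n) = Φ m * proj₁ (Φ-unit n) , mk≋ (trans (*-assoc _ _ _) (trans (*-congˡ (proj₂ (Φ-unit n))) (*-identityʳ _)))

    -- The sign is that of `u`, and entries are residues minus one. With c = d + 1, base 20 splits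
    -- into the residues c, c + 20, 20 - c, 40 - c modulo 40. For positive sign 1 + x = (1 - x²)/(1
    -- - x) puts these in the denominator and 2c, 40 - 2c in the numerator.
    θ-fraction : Sign → ℕ → Fraction
    θ-fraction Sgn.- d = 18 ℕ.∸ d ∷ 18 ℕ.∸ d ℕ.+ 20 ∷ d ∷ d ℕ.+ 20 ∷ [] , []
    θ-fraction Sgn.+ d = suc (18 ℕ.∸ d ℕ.+ (18 ℕ.∸ d)) ∷ suc (d ℕ.+ d) ∷ [] , 18 ℕ.∸ d ∷ 18 ℕ.∸ d ℕ.+ 20 ∷ d ∷ d ℕ.+ 20 ∷ []

    θ-≋ : ∀ s d → θ ⟦ s ⟧ₛ d ≋ θ-fraction s d
    θ-≋ Sgn.- d = mk≋ (trans (*-identityʳ _) (trans (*-cong (progression-20 (- 1#) (18 ℕ.∸ d)) (progression-20 (- 1#) d))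
      (solve 4 (λ a b c d → (a :* b) :* (c :* d) := a :* (b :* (c :* (d :* :1)))) refl _ _ _ _)))
      where open Solver
    θ-≋ Sgn.+ d = mk≋ (trans
      (solve 6 (λ x y a b c d → (x :* y) :* (a :* (b :* (c :* (d :* :1)))) := (x :* (a :* b)) :* (y :* (c :* d) :* :1)) refl _ _ _ _ _ _)
      (*-cong (progression-20-square (18 ℕ.∸ d)) (*-congʳ (progression-20-square d))))
      where open Solver

    Θ-fraction : Point → Point → Fraction
    Θ-fraction (s , a) (t , b) = θ-fraction (Sgn.opposite (s Sgn.* t)) (suc a ℕ.+ b) ⊗ θ-fraction (Sgn.opposite (s Sgn.* t)) (a ℕ.∸ suc b)

    Θ-≋ : ∀ p r → Θ p r ≋ Θ-fraction p r
    Θ-≋ (s , a) (t , b) = ≋-* (θ-≋ (Sgn.opposite (s Sgn.* t)) (suc a ℕ.+ b)) (θ-≋ (Sgn.opposite (s Sgn.* t)) (a ℕ.∸ suc b))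

    residues : (ℕ → Bool) → ℕ → List ℕ
    residues S zero = []
    residues S (suc i) = if S (suc i) then i ∷ residues S i else residues S i

    parts : (ℕ → Bool) → ℕ → Carrier
    parts S k = if S (suc k) then 1# + - 1# * q ^ suc k else 1#

    ∏-Φ : ∀ S n → ∏ N (λ k → ∏ n (λ i → if S (suc i) then 1# + - 1# * q ^ (suc i ℕ.+ k ℕ.* 40) else 1#)) ≈ Φ (residues S n)
    ∏-Φ S zero = ∏-ones N
    ∏-Φ S (suc n) with S (suc n)
    ... | true = trans (sym (∏-* N _ _)) (trans (*-comm _ _) (*-congˡ (∏-Φ S n)))
    ... | false = trans (∏-cong N (λ k → *-identityʳ _)) (∏-Φ S n)

    parts-Φ : ∀ S → (∀ i k → S (suc (i ℕ.+ k ℕ.* 40)) ≡ S (suc i)) → ∏ (N ℕ.* 40) (parts S) ≈ Φ (residues S 40)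
    parts-Φ S periodic = trans (∏-blocks N 40 (parts S)) (trans
      (∏-cong N (λ k → ∏-cong 40 (λ i → reflexive (≡.cong (λ b → if b then 1# + - 1# * q ^ (suc i ℕ.+ k ℕ.* 40) else 1#) (periodic i k)))))
      (∏-Φ S 40))

    -- The three-term relation multiplied by a fraction f, which is chosen to turn its terms into generating functions.
    weierstrass-≋ : ∀ s₁ a₁ s₂ a₂ s₃ a₃ s₄ a₄ δ f {A B C fA fB fC} → a₁ ≤ 8 → a₂ < a₁ → a₃ < a₂ → a₄ < a₃ → a₂ ≡ δ ℕ.+ a₃ →
      A ≋ fA → Θ-fraction (s₁ , a₁) (s₂ , a₂) ⊗ Θ-fraction (s₃ , a₃) (s₄ , a₄) ⊗ f ≐ fA →
      B ≋ fB → Θ-fraction (s₁ , a₁) (s₄ , a₄) ⊗ Θ-fraction (s₂ , a₂) (s₃ , a₃) ⊗ f ≐ fB →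
      C ≋ fC → Θ-fraction (s₁ , a₁) (s₃ , a₃) ⊗ Θ-fraction (s₂ , a₂) (s₄ , a₄) ⊗ f ≐ fC →
      q ^ (suc a₃ ℕ.+ suc a₄) * (⟦ s₂ ⟧ₛ * ⟦ s₃ ⟧ₛ * (q ^ δ * A) + B) ≈ q ^ (suc a₃ ℕ.+ suc a₄) * C
    weierstrass-≋ s₁ a₁ s₂ a₂ s₃ a₃ s₄ a₄ δ f {A} {B} {C} h₁ h₂ h₃ h₄ h₅ A≋ eqA B≋ eqB C≋ eqC = begin
      c * (κ * (q ^ δ * A) + B)
        ≈⟨ *-congˡ (+-cong (*-congˡ (*-congˡ (≋-unique eqA (term (s₁ , a₁) (s₂ , a₂) (s₃ , a₃) (s₄ , a₄)) A≋)))
             (≋-unique eqB (term (s₁ , a₁) (s₄ , a₄) (s₂ , a₂) (s₃ , a₃)) B≋)) ⟨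
      c * (κ * (q ^ δ * (X₁₂ * φ)) + X₁₄ * φ)
        ≈⟨ solve 6 (λ c κ d x y φ → c :* (κ :* (d :* (x :* φ)) :+ y :* φ) := c :* (κ :* d :* x :+ y) :* φ) refl c κ (q ^ δ) X₁₂ X₁₄ φ ⟩
      c * (κ * q ^ δ * X₁₂ + X₁₄) * φ
        ≈⟨ *-congʳ (weierstrass s₁ a₁ s₂ a₂ s₃ a₃ s₄ a₄ δ h₁ h₂ h₃ h₄ h₅) ⟩
      c * X₁₃ * φ
        ≈⟨ *-assoc c X₁₃ φ ⟩
      c * (X₁₃ * φ)
        ≈⟨ *-congˡ (≋-unique eqC (term (s₁ , a₁) (s₃ , a₃) (s₂ , a₂) (s₄ , a₄)) C≋) ⟩
      c * C ∎
      where
      open Solver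
      c = q ^ (suc a₃ ℕ.+ suc a₄)
      κ = ⟦ s₂ ⟧ₛ * ⟦ s₃ ⟧ₛ
      φ = proj₁ (inverse f)
      X₁₂ = Θ (s₁ , a₁) (s₂ , a₂) * Θ (s₃ , a₃) (s₄ , a₄)
      X₁₄ = Θ (s₁ , a₁) (s₄ , a₄) * Θ (s₂ , a₂) (s₃ , a₃)
      X₁₃ = Θ (s₁ , a₁) (s₃ , a₃) * Θ (s₂ , a₂) (s₄ , a₄)
      term : ∀ p₁ p₂ p₃ p₄ → Θ p₁ p₂ * Θ p₃ p₄ * φ ≋ Θ-fraction p₁ p₂ ⊗ Θ-fraction p₃ p₄ ⊗ f
      term p₁ p₂ p₃ p₄ = ≋-* (≋-* (Θ-≋ p₁ p₂) (Θ-≋ p₃ p₄)) (proj₂ (inverse f))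

    -- When x₂ and x₃ have opposite signs the coefficient of `q ^ δ * A` is -1, and this term moves
    -- to the other side.
    weierstrass-minus : ∀ s₁ a₁ s₂ a₂ s₃ a₃ s₄ a₄ δ f {A B C fA fB fC} → a₁ ≤ 8 → a₂ < a₁ → a₃ < a₂ → a₄ < a₃ → a₂ ≡ δ ℕ.+ a₃ →
      s₃ ≡ Sgn.opposite s₂ →
      A ≋ fA → Θ-fraction (s₁ , a₁) (s₂ , a₂) ⊗ Θ-fraction (s₃ , a₃) (s₄ , a₄) ⊗ f ≐ fA →
      B ≋ fB → Θ-fraction (s₁ , a₁) (s₄ , a₄) ⊗ Θ-fraction (s₂ , a₂) (s₃ , a₃) ⊗ f ≐ fB →
      C ≋ fC → Θ-fraction (s₁ , a₁) (s₃ , a₃) ⊗ Θ-fraction (s₂ , a₂) (s₄ , a₄) ⊗ f ≐ fC →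
      q ^ (suc a₃ ℕ.+ suc a₄) * B ≈ q ^ (suc a₃ ℕ.+ suc a₄) * (C + q ^ δ * A)
    weierstrass-minus s₁ a₁ s₂ a₂ s₃ a₃ s₄ a₄ δ f {A} {B} {C} h₁ h₂ h₃ h₄ h₅ s₃≡ A≋ eqA B≋ eqB C≋ eqC = begin
      c * B
        ≈⟨ solve 3 (λ c y b → c :* b := c :* (:- :1 :* y :+ b) :+ c :* y) refl c (q ^ δ * A) B ⟩
      c * (- 1# * (q ^ δ * A) + B) + c * (q ^ δ * A)
        ≈⟨ +-congʳ (*-congˡ (+-congʳ (*-congʳ κ≈-1))) ⟨
      c * (⟦ s₂ ⟧ₛ * ⟦ s₃ ⟧ₛ * (q ^ δ * A) + B) + c * (q ^ δ * A)
        ≈⟨ +-congʳ (weierstrass-≋ s₁ a₁ s₂ a₂ s₃ a₃ s₄ a₄ δ f h₁ h₂ h₃ h₄ h₅ A≋ eqA B≋ eqB C≋ eqC) ⟩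
      c * C + c * (q ^ δ * A)
        ≈⟨ distribˡ c C _ ⟨
      c * (C + q ^ δ * A) ∎
      where
      open Solver
      c = q ^ (suc a₃ ℕ.+ suc a₄)
      opposite-product : ∀ s → ⟦ s ⟧ₛ * ⟦ Sgn.opposite s ⟧ₛ ≈ - 1#
      opposite-product Sgn.+ = *-identityˡ (- 1#)
      opposite-product Sgn.- = *-identityʳ (- 1#)
      κ≈-1 : ⟦ s₂ ⟧ₛ * ⟦ s₃ ⟧ₛ ≈ - 1#
      κ≈-1 = trans (reflexive (≡.cong (λ s → ⟦ s₂ ⟧ₛ * ⟦ s ⟧ₛ) s₃≡)) (opposite-product s₂)

-- Recursion for partitions with bounded parts

module PartitionCounts where
  open import Data.Nat.Base using (_+_; _*_; _≤ᵇ_; _≡ᵇ_)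

  ≤ᵇ-true : ∀ {m n} → m ≤ n → (m ≤ᵇ n) ≡ true
  ≤ᵇ-true {m} {n} m≤n with m ≤ᵇ n | ℕₚ.≤⇒≤ᵇ m≤n
  ... | true | _ = ≡.refl

  ≤ᵇ-false : ∀ {m n} → n < m → (m ≤ᵇ n) ≡ false
  ≤ᵇ-false {m} {n} n<m with m ≤ᵇ n in eq
  ... | false = ≡.refl
  ... | true = contradiction (ℕₚ.≤ᵇ⇒≤ m n (≡.subst T (≡.sym eq) _)) (ℕₚ.<⇒≱ n<m)

  -- Each call lowers `n` by at least one, so fuel `n` is never exhausted before the sum over
  -- multiples ends.
  sumMult-fuel : ∀ k f {t t′} n → n ≤ t → n ≤ t′ → sumMult k f n t ≡ sumMult k f n t′
  sumMult-fuel k f {zero} {zero} n _ _ = ≡.refl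
  sumMult-fuel k f {zero} {suc t′} zero _ _ = ≡.sym (ℕₚ.+-identityʳ (f 0))
  sumMult-fuel k f {suc t} {zero} zero _ _ = ℕₚ.+-identityʳ (f 0)
  sumMult-fuel k f {suc t} {suc t′} n n≤t n≤t′ with suc k ≤ᵇ n
  ... | false = ≡.refl
  ... | true = ≡.cong (λ x → f n + x) (sumMult-fuel k f (n ∸ suc k) (drop n≤t) (drop n≤t′))
    where
    drop : ∀ {m t} → m ≤ suc t → m ∸ suc k ≤ t
    drop {m} m≤1+t = ℕₚ.≤-trans (ℕₚ.∸-monoʳ-≤ m (s≤s (z≤n {k}))) (ℕₚ.∸-monoˡ-≤ 1 m≤1+t)

  sumMult-< : ∀ k f {n} t → n ≤ k → sumMult k f n t ≡ f n
  sumMult-< k f zero n≤k = ≡.refl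
  sumMult-< k f {n} (suc t) n≤k rewrite ≤ᵇ-false {suc k} {n} (s≤s n≤k) = ℕₚ.+-identityʳ (f n)

  sumMult-+ : ∀ k f n → sumMult k f (suc k + n) (suc k + n) ≡ f (suc k + n) + sumMult k f n n
  sumMult-+ k f n rewrite ≤ᵇ-true (ℕₚ.m≤m+n (suc k) n) | ℕₚ.m+n∸m≡n k n =
    ≡.cong (λ x → f (suc k + n) + x) (sumMult-fuel k f n (ℕₚ.m≤n+m n k) ℕₚ.≤-refl)

  pBounded-suc : ∀ S {n} k → n ≤ k → pBounded S (suc k) n ≡ pBounded S k n
  pBounded-suc S {n} k n≤k with S (suc k)
  ... | true = sumMult-< k (pBounded S k) n n≤k
  ... | false = ≡.refl

  pBounded-stable : ∀ S {n} m → n ≤ m → pBounded S m n ≡ p S n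
  pBounded-stable S {n} m n≤m = ≡.subst (λ l → pBounded S l n ≡ p S n) (ℕₚ.m∸n+n≡m n≤m) (go (m ∸ n))
    where
    go : ∀ d → pBounded S (d + n) n ≡ p S n
    go zero = ≡.refl
    go (suc d) = ≡.trans (pBounded-suc S (d + n) (ℕₚ.m≤n+m n d)) (go d)

  pm40-periodic : ∀ rs i k → pm40 rs (suc (i + k * 40)) ≡ pm40 rs (suc i)
  pm40-periodic rs i k = ≡.cong (λ x → any (λ r → (x ≡ᵇ (r % 40)) ∨ (x ≡ᵇ ((40 ∸ (r % 40)) % 40))) rs) ([m+kn]%n≡m%n (suc i) k 40)

  S₁ T₁ S₂ T₂ S₃ T₃ S₄ T₄ : PosSet
  S₁ = pm40 (1 ∷ 3 ∷ 4 ∷ 5 ∷ 6 ∷ 7 ∷ 13 ∷ 15 ∷ 16 ∷ 17 ∷ 18 ∷ 19 ∷ [])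
  T₁ = pm40 (1 ∷ 2 ∷ 3 ∷ 5 ∷ 9 ∷ 11 ∷ 12 ∷ 15 ∷ 16 ∷ 17 ∷ 18 ∷ 19 ∷ [])
  S₂ = pm40 (3 ∷ 4 ∷ 5 ∷ 6 ∷ 7 ∷ 8 ∷ 9 ∷ 11 ∷ 13 ∷ 14 ∷ 15 ∷ 17 ∷ [])
  T₂ = pm40 (1 ∷ 3 ∷ 5 ∷ 8 ∷ 9 ∷ 11 ∷ 12 ∷ 14 ∷ 15 ∷ 17 ∷ 18 ∷ 19 ∷ [])
  S₃ = pm40 (1 ∷ 3 ∷ 4 ∷ 5 ∷ 6 ∷ 7 ∷ 8 ∷ 13 ∷ 14 ∷ 15 ∷ 17 ∷ 19 ∷ [])
  T₃ = pm40 (1 ∷ 2 ∷ 5 ∷ 6 ∷ 7 ∷ 8 ∷ 9 ∷ 11 ∷ 12 ∷ 13 ∷ 15 ∷ 19 ∷ [])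
  S₄ = pm40 (2 ∷ 3 ∷ 4 ∷ 5 ∷ 7 ∷ 9 ∷ 11 ∷ 13 ∷ 14 ∷ 15 ∷ 16 ∷ 17 ∷ [])
  T₄ = pm40 (1 ∷ 2 ∷ 5 ∷ 7 ∷ 9 ∷ 11 ∷ 12 ∷ 13 ∷ 15 ∷ 16 ∷ 18 ∷ 19 ∷ [])

-- Generating functions and the four instances of the relation

module GeneratingFunctions (N : ℕ) where
  open PartitionCounts
  open PowerSeries
  open import Data.Nat.Base using (_+_; _*_)
  open Truncated N
  open CommutativeRing commutativeRing hiding (zero; _≈_) renaming (_+_ to _⊕_; _*_ to _⊛_; -_ to ⊝_)
  open Nilpotent commutativeRing constants X N X^N≈0
  open Determinant (N + (N + N)) ℕₚ.≤-refl
  open import Algebra.Properties.Semiring.Exp semiring using (_^_)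

  bounded : PosSet → ℕ → Series
  bounded S k n = + pBounded S k n

  generating : PosSet → Series
  generating S n = + p S n

  -- Either no part equals k + 1, or one such part can be removed. In generating functions this says
  -- that the factor 1 - X^(k+1) takes the bound k + 1 back to k.
  bounded-suc : ∀ S k → S (suc k) ≡ true → ∀ n →
    bounded S (suc k) n ≡ bounded S k n Int.+ conv (X ^ suc k) (bounded S (suc k)) n
  bounded-suc S k Sk n with n ℕ.≤? k
  ... | yes n≤k = ≡.trans (≡.cong +_ (pBounded-suc S k n≤k))
    (≡.sym (≡.trans (≡.cong (λ x → bounded S k n Int.+ x) (X^-coeff-< (suc k) (bounded S (suc k)) n (s≤s n≤k))) (ℤₚ.+-identityʳ _)))
  ... | no n≰k = ≡.subst (λ m → bounded S (suc k) m ≡ bounded S k m Int.+ conv (X ^ suc k) (bounded S (suc k)) m)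
    (ℕₚ.m+[n∸m]≡n (ℕₚ.≰⇒> n≰k)) (step (n ∸ suc k))
    where
    unfold : ∀ m → pBounded S (suc k) m ≡ sumMult k (pBounded S k) m m
    unfold m = ≡.cong (λ b → if b then sumMult k (pBounded S k) m m else pBounded S k m) Sk
    step : ∀ m → bounded S (suc k) (suc k + m) ≡ bounded S k (suc k + m) Int.+ conv (X ^ suc k) (bounded S (suc k)) (suc k + m)
    step m = ≡.trans (≡.cong +_ (≡.trans (unfold (suc k + m)) (≡.trans (sumMult-+ k (pBounded S k) m)
        (≡.cong (λ x → pBounded S k (suc k + m) + x) (≡.sym (unfold m))))))
      (≡.cong (λ x → bounded S k (suc k + m) Int.+ x) (≡.sym (X^-coeff (suc k) (bounded S (suc k)) m)))

  parts-bounded : ∀ S k → parts S k ⊛ bounded S (suc k) ≈ bounded S k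
  parts-bounded S k = by-cases (S (suc k)) ≡.refl
    where
    open Solver
    by-cases : ∀ b → S (suc k) ≡ b → parts S k ⊛ bounded S (suc k) ≈ bounded S k
    by-cases true Sk = trans (reflexive (≡.cong (λ b → (if b then 1# ⊕ ⊝ 1# ⊛ X ^ suc k else 1#) ⊛ bounded S (suc k)) Sk))
      (trans (solve 2 (λ x b → (:1 :+ :- :1 :* x) :* b := b :- x :* b) refl (X ^ suc k) (bounded S (suc k)))
      (trans (+-congʳ (pointwise (bounded-suc S k Sk)))
        (solve 2 (λ b y → b :+ y :- y := b) refl (bounded S k) (X ^ suc k ⊛ bounded S (suc k)))))
    by-cases false Sk = trans (reflexive (≡.cong (λ b → (if b then 1# ⊕ ⊝ 1# ⊛ X ^ suc k else 1#) ⊛ bounded S (suc k)) Sk))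
      (trans (*-identityˡ _) (pointwise (λ n → ≡.cong (λ b → + (if b then sumMult k (pBounded S k) n n else pBounded S k n)) Sk)))

  ∏-parts-bounded : ∀ S k → ∏ k (parts S) ⊛ bounded S k ≈ 1#
  ∏-parts-bounded S zero = trans (*-identityˡ _) (pointwise λ { zero → ≡.refl ; (suc n) → ≡.refl })
  ∏-parts-bounded S (suc k) = trans (*-assoc _ _ _) (trans (*-congˡ (parts-bounded S k)) (∏-parts-bounded S k))

  -- Parts above the degree do not matter, so below degree `N` the bound N * 40 is large enough;
  -- being a whole number of periods, it lets the product split by residue.
  generating-≋ : ∀ rs → generating (pm40 rs) ≋ ([] , residues (pm40 rs) 40)
  generating-≋ rs = mk≋ (trans (*-comm _ _) (trans
    (*-cong (sym (parts-Φ S (pm40-periodic rs)))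
      (mk≈ (λ n n<N → ≡.cong +_ (≡.sym (pBounded-stable S (N * 40) (ℕₚ.≤-trans (ℕₚ.<⇒≤ n<N) (ℕₚ.m≤m*n N 40)))))))
    (∏-parts-bounded S (N * 40))))
    where S = pm40 rs

  one-≋ : 1# ≋ ([] , [])
  one-≋ = mk≋ (*-identityˡ 1#)

  -- `X` is nilpotent here, so cancelling `X ^ e` keeps only the coefficients below N - e.
  cancel-X^ : ∀ e {f g} → X ^ e ⊛ f ≈ X ^ e ⊛ g → ∀ n → e + n < N → f n ≡ g n
  cancel-X^ e {f} {g} p n e+n<N = ≡.trans (≡.sym (X^-coeff e f n)) (≡.trans (coeff p (e + n) e+n<N) (X^-coeff e g n))

  -- In each part the fraction is the inverse of the term of the three-term relation that is to become 1#.
  shifted-1 : ∀ n → 4 + n < N → generating S₁ n ≡ (1# ⊕ X ^ 1 ⊛ generating T₁) n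
  shifted-1 = cancel-X^ 4 (weierstrass-minus Sgn.- 4 Sgn.+ 3 Sgn.- 2 Sgn.+ 0 1
    (swap (Θ-fraction (Sgn.- , 4) (Sgn.- , 2) ⊗ Θ-fraction (Sgn.+ , 3) (Sgn.+ , 0)))
    (ℕₚ.m≤m+n 4 4) ℕₚ.≤-refl ℕₚ.≤-refl (s≤s z≤n) ≡.refl ≡.refl
    (generating-≋ _) ≡.refl (generating-≋ _) ≡.refl one-≋ ≡.refl)

  shifted-3 : ∀ n → 3 + n < N → generating S₂ n ≡ (1# ⊕ X ^ 3 ⊛ generating T₂) n
  shifted-3 = cancel-X^ 3 (weierstrass-minus Sgn.- 6 Sgn.+ 4 Sgn.- 1 Sgn.+ 0 3
    (swap (Θ-fraction (Sgn.- , 6) (Sgn.- , 1) ⊗ Θ-fraction (Sgn.+ , 4) (Sgn.+ , 0)))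
    (ℕₚ.m≤m+n 6 2) (ℕₚ.m≤m+n 5 1) (ℕₚ.m≤m+n 2 2) (s≤s z≤n) ≡.refl ≡.refl
    (generating-≋ _) ≡.refl (generating-≋ _) ≡.refl one-≋ ≡.refl)

  -- T₁₂T₃₄ is the term divided out, so the 1 carries the power of X: the two generating functions
  -- differ by X² alone.
  shiftless : ∀ n → 6 + n < N → generating T₃ n ≡ (generating S₃ ⊕ X ^ 2 ⊛ 1#) n
  shiftless = cancel-X^ 6 (weierstrass-minus Sgn.- 7 Sgn.- 6 Sgn.+ 4 Sgn.+ 0 2
    (swap (Θ-fraction (Sgn.- , 7) (Sgn.- , 6) ⊗ Θ-fraction (Sgn.+ , 4) (Sgn.+ , 0)))
    (ℕₚ.m≤m+n 7 1) ℕₚ.≤-refl (ℕₚ.m≤m+n 5 1) (s≤s z≤n) ≡.refl ≡.refl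
    one-≋ ≡.refl (generating-≋ _) ≡.refl (generating-≋ _) ≡.refl)

  -- Here x₂ = -q⁵ and x₃ = -q³ have equal signs, so all three terms keep positive coefficients, and
  -- T₁₄T₂₃ is the one that becomes 1.
  shifted-2 : ∀ n → 4 + n < N → (1# ⊕ X ^ 2 ⊛ generating T₄) n ≡ generating S₄ n
  shifted-2 = cancel-X^ 4 (trans
    (*-congˡ (solve 2 (λ o y → o :+ y := :- :1 :* :- :1 :* y :+ o) refl 1# (X ^ 2 ⊛ generating T₄)))
    (weierstrass-≋ Sgn.+ 5 Sgn.- 4 Sgn.- 2 Sgn.+ 0 2
    (swap (Θ-fraction (Sgn.+ , 5) (Sgn.+ , 0) ⊗ Θ-fraction (Sgn.- , 4) (Sgn.- , 2)))
    (ℕₚ.m≤m+n 5 3) ℕₚ.≤-refl (ℕₚ.m≤m+n 3 1) (s≤s z≤n) ≡.refl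
    (generating-≋ _) ≡.refl one-≋ ≡.refl (generating-≋ _) ≡.refl))
    where open Solver

  shifted-coefficient : ∀ δ f m → (1# ⊕ X ^ suc δ ⊛ f) (suc δ + m) ≡ f m
  shifted-coefficient δ f m = ≡.trans (ℤₚ.+-identityˡ _) (X^-coeff (suc δ) f m)

  X²-coefficient : ∀ n → n ≢ 2 → (X ^ 2 ⊛ 1#) n ≡ Int.0ℤ
  X²-coefficient 0 _ = ≡.refl
  X²-coefficient 1 _ = ≡.refl
  X²-coefficient 2 n≢2 = contradiction ≡.refl n≢2
  X²-coefficient (suc (suc (suc n))) _ = X^-coeff 2 1# (suc n)

-- Reading off single coefficients

private
  -- The least truncation in which coefficient `n` survives the cancellation of X^e.
  module At (e n : ℕ) where
    open GeneratingFunctions (e ℕ.+ suc n) public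

    within : e ℕ.+ n < e ℕ.+ suc n
    within = ℕₚ.+-monoʳ-< e ℕₚ.≤-refl

open PartitionCounts

theorem4p2 : ((n : ℕ) → 1 ≤ n →
    p (pm40 (1 ∷ 3 ∷ 4 ∷ 5 ∷ 6 ∷ 7 ∷ 13 ∷ 15 ∷ 16 ∷ 17 ∷ 18 ∷ 19 ∷ [])) n
    ≡ p (pm40 (1 ∷ 2 ∷ 3 ∷ 5 ∷ 9 ∷ 11 ∷ 12 ∷ 15 ∷ 16 ∷ 17 ∷ 18 ∷ 19 ∷ [])) (n ∸ 1))
    × ((n : ℕ) → 3 ≤ n →
    p (pm40 (3 ∷ 4 ∷ 5 ∷ 6 ∷ 7 ∷ 8 ∷ 9 ∷ 11 ∷ 13 ∷ 14 ∷ 15 ∷ 17 ∷ [])) n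
    ≡ p (pm40 (1 ∷ 3 ∷ 5 ∷ 8 ∷ 9 ∷ 11 ∷ 12 ∷ 14 ∷ 15 ∷ 17 ∷ 18 ∷ 19 ∷ [])) (n ∸ 3))
    × ((n : ℕ) → n ≢ 2 →
    p (pm40 (1 ∷ 3 ∷ 4 ∷ 5 ∷ 6 ∷ 7 ∷ 8 ∷ 13 ∷ 14 ∷ 15 ∷ 17 ∷ 19 ∷ [])) n
    ≡ p (pm40 (1 ∷ 2 ∷ 5 ∷ 6 ∷ 7 ∷ 8 ∷ 9 ∷ 11 ∷ 12 ∷ 13 ∷ 15 ∷ 19 ∷ [])) n)
    × ((n : ℕ) → 2 ≤ n →
    p (pm40 (2 ∷ 3 ∷ 4 ∷ 5 ∷ 7 ∷ 9 ∷ 11 ∷ 13 ∷ 14 ∷ 15 ∷ 16 ∷ 17 ∷ [])) n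
    ≡ p (pm40 (1 ∷ 2 ∷ 5 ∷ 7 ∷ 9 ∷ 11 ∷ 12 ∷ 13 ∷ 15 ∷ 16 ∷ 18 ∷ 19 ∷ [])) (n ∸ 2))
theorem4p2 = part-i , part-ii , part-iii , part-iv
  where
  part-i : ∀ n → 1 ≤ n → p S₁ n ≡ p T₁ (n ∸ 1)
  part-i (suc m) _ = ℤₚ.+-injective (≡.trans (shifted-1 (suc m) within) (shifted-coefficient 0 (generating T₁) m))
    where open At 4 (suc m)

  part-ii : ∀ n → 3 ≤ n → p S₂ n ≡ p T₂ (n ∸ 3)
  part-ii (suc (suc (suc m))) (s≤s (s≤s (s≤s z≤n))) = ℤₚ.+-injective (≡.trans (shifted-3 (suc (suc (suc m))) within) (shifted-coefficient 2 (generating T₂) m))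
    where open At 3 (suc (suc (suc m)))

  part-iii : ∀ n → n ≢ 2 → p S₃ n ≡ p T₃ n
  part-iii n n≢2 = ≡.sym (ℤₚ.+-injective (≡.trans (shiftless n within) (≡.trans (≡.cong (λ x → generating S₃ n Int.+ x) (X²-coefficient n n≢2)) (ℤₚ.+-identityʳ _))))
    where
    open At 6 n

  part-iv : ∀ n → 2 ≤ n → p S₄ n ≡ p T₄ (n ∸ 2)
  part-iv (suc (suc m)) (s≤s (s≤s z≤n)) = ≡.sym (ℤₚ.+-injective (≡.trans (≡.sym (shifted-coefficient 1 (generating T₄) m)) (shifted-2 (suc (suc m)) within)))
    where open At 4 (suc (suc m))
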